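{- Let $k$ be a positive integer with $k \equiv 12 \pmod{15}$ and let \[ n = L_{CC}(10,k) = \frac{512k^5+1280k^4+6080k^3+7840k^2+10010k+3741}{3125}. \] Then there is an undirected Cayley graph of the cyclic group $\mathbb{Z}_n$ on five generators which has diameter $k$. Moreover, a generating set for such a graph is \[ \Big\{1,\ \tfrac{128k^4+256k^3+1192k^2+1064k+883}{625},\ \tfrac{512k^5+1920k^4+6560k^3+14600k^2+7980k+10431}{9375},\ \tfrac{512k^5+1920k^4+6560k^3+14600k^2+15480k+14181}{9375},\ \tfrac{512k^5+1920k^4+8960k^3+18200k^2+28530k+20106}{9375}\Big\}, \] i.e. the Cayley graph of $\mathbb{Z}_n$ with connection set $\{\pm g_1,\dots,\pm g_5\}$, where $g_1,\dots,g_5$ are these integers taken modulo $n$, has diameter $k$.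
   Context: For a positive integer $n$ and integers $g_1,\dots,g_5$, the undirected Cayley (circulant) graph of the cyclic group $\mathbb{Z}_n$ with generating set $\{g_1,\dots,g_5\}$ has vertex set $\mathbb{Z}_n$, with $i$ and $j$ adjacent if and only if $j-i \equiv \pm g_t \pmod n$ for some $t$. Its diameter is the maximum over pairs of vertices of the graph distance. The notation $L_{CC}(10,k)$ is just a name for the displayed polynomial value. -}

module Defs where

open import Data.Nat using (ℕ; zero; suc; _+_; _*_; _^_; _≤_; pred)
open import Data.Nat.DivMod using (_/_)
open import Data.Integer as ℤ using (ℤ; +_)
open import Data.Fin using (Fin; toℕ)
open import Data.List using (List; _∷_; [])
open import Data.List.Membership.Propositional using (_∈_)
open import Data.Product using (Σ; ∃; _×_; _,_)
open import Data.Sum using (_⊎_)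
open import Relation.Nullary using (¬_)
open import Relation.Binary.PropositionalEquality using (_≡_)

CongMod : ℤ → ℤ → ℕ → Set
CongMod a b n = Σ ℤ λ z → a ℤ.- b ≡ z ℤ.* (+ n)

Adj : (n : ℕ) → List ℕ → Fin n → Fin n → Set
Adj n gs i j = Σ ℕ λ g → g ∈ gs ×
  ((CongMod (+ toℕ j ℤ.- + toℕ i) (+ g) n) ⊎ (CongMod (+ toℕ j ℤ.- + toℕ i) (ℤ.- (+ g)) n))

data Walk (n : ℕ) (gs : List ℕ) : Fin n → Fin n → ℕ → Set where
  nil  : ∀ {i} → Walk n gs i i 0
  cons : ∀ {i j l d} → Adj n gs i j → Walk n gs j l d → Walk n gs i l (suc d)

DistLe : (n : ℕ) → List ℕ → Fin n → Fin n → ℕ → Set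
DistLe n gs i j d = Σ ℕ λ d' → d' ≤ d × Walk n gs i j d'

-- The circulant graph has diameter exactly k (k ≥ 1): every pair is at distance ≤ k,
-- and some pair is at distance > k - 1.
HasDiameter : (n : ℕ) → List ℕ → ℕ → Set
HasDiameter n gs k =
  (∀ i j → DistLe n gs i j k) × (Σ (Fin n) λ i → Σ (Fin n) λ j → ¬ DistLe n gs i j (pred k))

-- The polynomials from the statement (exact divisions when k ≡ 12 mod 15).
LCC10 : ℕ → ℕ
LCC10 k = (512 * k ^ 5 + 1280 * k ^ 4 + 6080 * k ^ 3 + 7840 * k ^ 2 + 10010 * k + 3741) / 3125

gen2 gen3 gen4 gen5 : ℕ → ℕ
gen2 k = (128 * k ^ 4 + 256 * k ^ 3 + 1192 * k ^ 2 + 1064 * k + 883) / 625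
gen3 k = (512 * k ^ 5 + 1920 * k ^ 4 + 6560 * k ^ 3 + 14600 * k ^ 2 + 7980 * k + 10431) / 9375
gen4 k = (512 * k ^ 5 + 1920 * k ^ 4 + 6560 * k ^ 3 + 14600 * k ^ 2 + 15480 * k + 14181) / 9375
gen5 k = (512 * k ^ 5 + 1920 * k ^ 4 + 8960 * k ^ 3 + 18200 * k ^ 2 + 28530 * k + 20106) / 9375

generators : ℕ → List ℕ
generators k = 1 ∷ gen2 k ∷ gen3 k ∷ gen4 k ∷ gen5 k ∷ []

{-# OPTIONS --safe #-}

-- Put k = 15m + 12 and a = (2k + 1) / 5 = 6m + 5.  The kernel of φ : ℤ⁵ → ℤₙ, φ x = ∑ gᵢ xᵢ, is the
-- lattice of all a s + ½ M s with s ∈ ℤ⁵ having entries of equal parity, where M is a skew matrix whose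
-- entries -1, 0, 1 orient two triangles sharing a vertex.  The diameter is k once every x with
-- ‖x‖₁ = k + 1 can be shortened by a lattice vector and some x cannot be brought below norm k.
--
-- Shortening.  Let ε be a sign vector of x and y = |x|.  Skewness gives ‖a ε + ½ M ε‖₁ = 5a = 2k + 1, so
-- subtracting this vector leaves norm k unless some yᵢ exceeds a + ½ εᵢ (M ε)ᵢ.  Such a large yᵢ is
-- reduced by the lattice vector near 2a εᵢ eᵢ, again by skewness, except that a zero coordinate of x adjacent
-- to i costs 1 whatever its sign.  But then that sign is free and can be chosen to suit i.  At most two
-- coordinates are large; as any two vertices have one common neighbour, their wishes can conflict at
-- one zero coordinate only, and if neither choice works the lattice vector near 2a (εₚ eₚ + ε_q e_q) does.
--
-- Lower bound.  A point with all coordinates near a / 2 and norm k has distance at least k from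
-- every lattice point, because M is small compared with a.

module Submission where

open import Defs
open import Data.Fin using (Fin; zero; suc; toℕ; fromℕ<)
open import Data.Fin.Properties using (_≟_; all?; any?; toℕ<n; toℕ-fromℕ<; toℕ-injective)
open import Data.Integer hiding (_≟_; NonZero)
import Data.Integer as ℤ
open import Data.Integer.DivMod using (_%ℕ_; _/ℕ_; n%ℕd<d; a≡a%ℕn+[a/ℕn]*n)
open import Data.Integer.Properties hiding (_≟_)
open import Data.Integer.Tactic.RingSolver using (solve; solve-∀)
open import Data.List using (List; _∷_; [])
open import Data.List.Membership.Propositional using (_∈_)
open import Data.List.Relation.Unary.Any using (here; there)
open import Data.Nat as ℕ using (ℕ; NonZero)
import Data.Nat.DivMod as ℕ
import Data.Nat.Properties as ℕ
open import Data.Product using (Σ; ∃; _×_; _,_; proj₁; proj₂)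
open import Data.Sum using (_⊎_; inj₁; inj₂)
open import Data.Unit using (tt)
open import Function using (_∘_)
open import Relation.Binary.PropositionalEquality
open import Relation.Nullary using (Dec; yes; no; contradiction; ¬_)
open import Relation.Nullary.Decidable using (_×-dec_; _→-dec_; ¬?; toWitness)

-- Integer inequalities, signs and absolute values.

infixl 6 _⊕_

≰⇒suc≤ : ∀ {i j} → ¬ i ≤ j → 1ℤ + j ≤ i
≰⇒suc≤ = i<j⇒suc[i]≤j ∘ ≰⇒>

_⊕_ : ∀ {i j} → 0ℤ ≤ i → 0ℤ ≤ j → 0ℤ ≤ i + j
p ⊕ q = +-mono-≤ p q

slack : ∀ {i j} → i ≤ j → 0ℤ ≤ j - i
slack = i≤j⇒0≤j-i

-- Linear inequalities are proved by exhibiting the slack of the goal as a sum of slacks of hypotheses,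
-- which leaves a ring identity.
linear : ∀ {i j s} → 0ℤ ≤ s → j - i ≡ s → i ≤ j
linear p refl = 0≤i-j⇒j≤i p

*-nonneg : ∀ {i j} → 0ℤ ≤ i → 0ℤ ≤ j → 0ℤ ≤ i * j
*-nonneg {i} {+ n} 0≤i (+≤+ _) = *-monoʳ-≤-nonNeg (+ n) 0≤i

abs : ℤ → ℤ
abs i = + ∣ i ∣

0≤abs : ∀ i → 0ℤ ≤ abs i
0≤abs i = +≤+ ℕ.z≤n

data IsUnit : ℤ → Set where
  plus  : IsUnit 1ℤ
  minus : IsUnit -1ℤ

data IsTrit : ℤ → Set where
  plus  : IsTrit 1ℤ
  null  : IsTrit 0ℤ
  minus : IsTrit -1ℤ

unit*trit : ∀ {e α} → IsUnit e → IsTrit α → IsTrit (e * α)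
unit*trit plus  plus  = plus
unit*trit plus  null  = null
unit*trit plus  minus = minus
unit*trit minus plus  = minus
unit*trit minus null  = null
unit*trit minus minus = plus

neg-trit : ∀ {α} → IsTrit α → IsTrit (- α)
neg-trit plus  = minus
neg-trit null  = null
neg-trit minus = plus

unit² : ∀ {e} → IsUnit e → e * e ≡ 1ℤ
unit² plus  = refl
unit² minus = refl

i≤abs : ∀ i → i ≤ abs i
i≤abs (+ _)    = ≤-refl
i≤abs -[1+ _ ] = -≤+

abs-≤ : ∀ {i c} → i ≤ c → - i ≤ c → abs i ≤ c
abs-≤ {+ _}       i≤c _    = i≤c
abs-≤ { -[1+ _ ]} _   -i≤c = -i≤c

abs-neg : ∀ i → abs (- i) ≡ abs i
abs-neg i = cong +_ (∣-i∣≡∣i∣ i)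

abs-unit* : ∀ {e} → IsUnit e → ∀ i → abs (e * i) ≡ abs i
abs-unit* plus  i = cong abs (*-identityˡ i)
abs-unit* minus i = trans (cong abs (-1*i≡-i i)) (abs-neg i)

abs-*-unit : ∀ {e} → IsUnit e → ∀ i → abs (i * e) ≡ abs i
abs-*-unit {e} e-unit i = trans (cong abs (*-comm i e)) (abs-unit* e-unit i)

abs-sym : ∀ i j → abs (i - j) ≡ abs (j - i)
abs-sym i j = cong +_ (∣i-j∣≡∣j-i∣ i j)

abs-triangle : ∀ i j → abs (i + j) ≤ abs i + abs j
abs-triangle i j = subst (abs (i + j) ≤_) (pos-+ ∣ i ∣ ∣ j ∣) (+≤+ (∣i+j∣≤∣i∣+∣j∣ i j))

abs-product : ∀ i j → abs (i * j) ≡ abs i * abs j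
abs-product i j = trans (cong +_ (∣i*j∣≡∣i∣*∣j∣ i j)) (pos-* ∣ i ∣ ∣ j ∣)

-- How an absolute value changes when trits are added.

shift : ℤ → ℤ → ℤ
shift i α = abs (i + α) - abs i

shift-≤ : ∀ i α → shift i α ≤ abs α
shift-≤ i α = linear (slack (abs-triangle i α)) (lemma (abs i) (abs α) (abs (i + α)))
  where
  lemma : ∀ i α s → α - (s - i) ≡ i + α - s
  lemma = solve-∀

abs[e*y+α] : ∀ {e} → IsUnit e → ∀ y α → abs (e * y + α) ≡ abs (y + e * α)
abs[e*y+α] {e} e-unit y α = trans (sym (abs-unit* e-unit (e * y + α))) (cong abs
  (trans (lemma e y α) (cong (_+ e * α) (trans (cong (_* y) (unit² e-unit)) (*-identityˡ y)))))
  where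
  lemma : ∀ e y α → e * (e * y + α) ≡ e * e * y + e * α
  lemma = solve-∀

0≤1+trit : ∀ {α} → IsTrit α → 0ℤ ≤ 1ℤ + α
0≤1+trit plus  = +≤+ ℕ.z≤n
0≤1+trit null  = +≤+ ℕ.z≤n
0≤1+trit minus = +≤+ ℕ.z≤n

0≤1+trits : ∀ {e α γ} → IsUnit e → IsTrit α → IsTrit γ → 0ℤ ≤ 1ℤ + e * (α + γ) + abs (α * γ)
0≤1+trits plus  plus  plus  = +≤+ ℕ.z≤n
0≤1+trits plus  plus  null  = +≤+ ℕ.z≤n
0≤1+trits plus  plus  minus = +≤+ ℕ.z≤n
0≤1+trits plus  null  plus  = +≤+ ℕ.z≤n
0≤1+trits plus  null  null  = +≤+ ℕ.z≤n
0≤1+trits plus  null  minus = +≤+ ℕ.z≤n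
0≤1+trits plus  minus plus  = +≤+ ℕ.z≤n
0≤1+trits plus  minus null  = +≤+ ℕ.z≤n
0≤1+trits plus  minus minus = +≤+ ℕ.z≤n
0≤1+trits minus plus  plus  = +≤+ ℕ.z≤n
0≤1+trits minus plus  null  = +≤+ ℕ.z≤n
0≤1+trits minus plus  minus = +≤+ ℕ.z≤n
0≤1+trits minus null  plus  = +≤+ ℕ.z≤n
0≤1+trits minus null  null  = +≤+ ℕ.z≤n
0≤1+trits minus null  minus = +≤+ ℕ.z≤n
0≤1+trits minus minus plus  = +≤+ ℕ.z≤n
0≤1+trits minus minus null  = +≤+ ℕ.z≤n
0≤1+trits minus minus minus = +≤+ ℕ.z≤n

-- A nonzero integer cannot cross zero when a trit is added, so its absolute value changes linearly.
shift-nonzero : ∀ {e α y} → IsUnit e → IsTrit α → 1ℤ ≤ y → shift (e * y) α ≡ α * e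
shift-nonzero {e} {α} {y} e-unit α-trit 1≤y = trans
  (cong₂ _-_ (trans (abs[e*y+α] e-unit y α) (0≤i⇒+∣i∣≡i {y + e * α} (linear (slack 1≤y
    ⊕ 0≤1+trit (unit*trit e-unit α-trit)) (lemma₁ y (e * α)))))
             (trans (abs-unit* e-unit y) (0≤i⇒+∣i∣≡i {y} (≤-trans (+≤+ ℕ.z≤n) 1≤y))))
  (lemma₂ y e α)
  where
  lemma₁ : ∀ y α → y + α - 0ℤ ≡ y - 1ℤ + (1ℤ + α)
  lemma₁ = solve-∀
  lemma₂ : ∀ y e α → y + e * α - y ≡ α * e
  lemma₂ = solve-∀

-- Two trits push `e * y` across zero only if `y` is 1 and both oppose `e`. Then `α * γ` is nonzero,
-- and the last term pays for the overshoot.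
shift₂-nonzero : ∀ {e α γ y} → IsUnit e → IsTrit α → IsTrit γ → 1ℤ ≤ y →
  abs (e * y + (α + γ)) ≤ y + e * (α + γ) + + 2 * abs (α * γ)
shift₂-nonzero {e} {α} {γ} {y} e-unit α-trit γ-trit 1≤y =
  subst (_≤ y + e * (α + γ) + + 2 * abs (α * γ)) (sym (abs[e*y+α] e-unit y (α + γ)))
    (abs-≤ (linear (0≤abs (α * γ) ⊕ 0≤abs (α * γ)) (lemma₁ (y + e * (α + γ)) (abs (α * γ))))
           (linear (slack 1≤y ⊕ slack 1≤y ⊕ 0≤1+trits e-unit α-trit γ-trit ⊕ 0≤1+trits e-unit α-trit γ-trit)
                   (lemma₂ y (e * (α + γ)) (abs (α * γ)))))
  where
  lemma₁ : ∀ s t → s + + 2 * t - s ≡ t + t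
  lemma₁ = solve-∀
  lemma₂ : ∀ y s t → y + s + + 2 * t - - (y + s) ≡ y - 1ℤ + (y - 1ℤ) + (1ℤ + s + t) + (1ℤ + s + t)
  lemma₂ = solve-∀

-- The sign of i; at i = 0 it is free and made to agree with α, or with γ if α = 0.
pick : ℤ → ℤ → ℤ → ℤ
pick +[1+ _ ] _  _  = 1ℤ
pick -[1+ _ ] _  _  = -1ℤ
pick +0       +0 +0 = 1ℤ
pick +0       +0 γ  = γ
pick +0       α  _  = α

pick-unit : ∀ i {α γ} → IsTrit α → IsTrit γ → IsUnit (pick i α γ)
pick-unit +[1+ _ ] _ _ = plus
pick-unit -[1+ _ ] _ _ = minus
pick-unit +0 plus  _     = plus
pick-unit +0 null  plus  = plus
pick-unit +0 null  null  = plus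
pick-unit +0 null  minus = minus
pick-unit +0 minus _     = minus

pick-sign : ∀ i α γ → i ≡ pick i α γ * abs i
pick-sign +[1+ n ] _ _ = sym (*-identityˡ +[1+ n ])
pick-sign -[1+ n ] _ _ = sym (-1*i≡-i +[1+ n ])
pick-sign +0 +0       +0       = refl
pick-sign +0 +0       +[1+ n ] = sym (*-zeroʳ +[1+ n ])
pick-sign +0 +0       -[1+ n ] = sym (*-zeroʳ -[1+ n ])
pick-sign +0 +[1+ n ] _        = sym (*-zeroʳ +[1+ n ])
pick-sign +0 -[1+ n ] _        = sym (*-zeroʳ -[1+ n ])

pick-nonzero : ∀ {i} α γ α′ γ′ → 1ℤ ≤ abs i → pick i α γ ≡ pick i α′ γ′
pick-nonzero {+[1+ _ ]} _ _ _ _ _ = refl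
pick-nonzero { -[1+ _ ]} _ _ _ _ _ = refl
pick-nonzero {+0} _ _ _ _ (+≤+ ())

nonzero : ∀ i → i ≡ 0ℤ ⊎ 1ℤ ≤ abs i
nonzero +0       = inj₁ refl
nonzero +[1+ n ] = inj₂ (+≤+ (ℕ.s≤s ℕ.z≤n))
nonzero -[1+ n ] = inj₂ (+≤+ (ℕ.s≤s ℕ.z≤n))

shift-pick : ∀ i {α γ δ} → IsTrit α → IsTrit γ → IsTrit δ → 1ℤ ≤ abs i → shift i δ ≡ δ * pick i α γ
shift-pick i {α} {γ} {δ} α-trit γ-trit δ-trit 1≤i =
  trans (cong (λ x → shift x δ) (pick-sign i α γ)) (shift-nonzero (pick-unit i α-trit γ-trit) δ-trit 1≤i)

-- At `i = 0` the change is `abs α`, and `pick` attains it because `α` has the first claim on the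
-- free sign.
shift-favoured : ∀ i {α γ} → IsTrit α → IsTrit γ → shift i α ≡ α * pick i α γ
shift-favoured i α-trit γ-trit with nonzero i
... | inj₂ 1≤i = shift-pick i α-trit γ-trit α-trit 1≤i
shift-favoured _ plus  _     | inj₁ refl = refl
shift-favoured _ null  _     | inj₁ refl = refl
shift-favoured _ minus _     | inj₁ refl = refl

-- The second claim `γ` is refused only at a zero with `α = - γ ≠ 0`. There `γ * pick i α γ` is -1
-- instead of 1, a loss of 2.
shift-other : ∀ i {α γ} → IsTrit α → IsTrit γ → shift i γ - + 2 * abs (α * γ) ≤ γ * pick i α γ
shift-other i {α} {γ} α-trit γ-trit with nonzero i
... | inj₂ 1≤i = linear (0≤abs (α * γ) ⊕ 0≤abs (α * γ))
  (trans (cong (λ s → γ * pick i α γ - (s - + 2 * abs (α * γ))) (shift-pick i α-trit γ-trit γ-trit 1≤i))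
    (lemma (γ * pick i α γ) (abs (α * γ))))
  where
  lemma : ∀ s t → s - (s - + 2 * t) ≡ t + t
  lemma = solve-∀
shift-other _ plus  plus  | inj₁ refl = -≤+
shift-other _ plus  null  | inj₁ refl = ≤-refl
shift-other _ plus  minus | inj₁ refl = ≤-refl
shift-other _ null  plus  | inj₁ refl = ≤-refl
shift-other _ null  null  | inj₁ refl = ≤-refl
shift-other _ null  minus | inj₁ refl = ≤-refl
shift-other _ minus plus  | inj₁ refl = ≤-refl
shift-other _ minus null  | inj₁ refl = ≤-refl
shift-other _ minus minus | inj₁ refl = -≤+

-- Sharp when α γ = 0 and at a conflict (i = 0 and α = - γ ≠ 0), which is all that reduce-plane needs.
shift₂ : ∀ i {α γ} → IsTrit α → IsTrit γ →
  abs (i + (α + γ)) ≤ abs i + (shift i α + + 2 * (γ * pick i α γ) - shift i γ + + 2 * abs (α * γ))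
shift₂ i {α} {γ} α-trit γ-trit with nonzero i
... | inj₂ 1≤i = subst₂ _≤_
  (cong (λ x → abs (x + (α + γ))) (sym (pick-sign i α γ)))
  (trans (lemma (abs i) (pick i α γ) α γ (abs (α * γ)))
    (cong₂ (λ s t → abs i + (s + + 2 * (γ * pick i α γ) - t + + 2 * abs (α * γ)))
       (sym (shift-pick i α-trit γ-trit α-trit 1≤i)) (sym (shift-pick i α-trit γ-trit γ-trit 1≤i))))
  (shift₂-nonzero (pick-unit i α-trit γ-trit) α-trit γ-trit 1≤i)
  where
  lemma : ∀ y e α γ t → y + e * (α + γ) + + 2 * t ≡ y + (α * e + + 2 * (γ * e) - γ * e + + 2 * t)
  lemma = solve-∀
shift₂ _ plus  plus  | inj₁ refl = +≤+ (ℕ.s≤s (ℕ.s≤s ℕ.z≤n))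
shift₂ _ plus  null  | inj₁ refl = ≤-refl
shift₂ _ plus  minus | inj₁ refl = ≤-refl
shift₂ _ null  plus  | inj₁ refl = ≤-refl
shift₂ _ null  null  | inj₁ refl = ≤-refl
shift₂ _ null  minus | inj₁ refl = ≤-refl
shift₂ _ minus plus  | inj₁ refl = ≤-refl
shift₂ _ minus null  | inj₁ refl = ≤-refl
shift₂ _ minus minus | inj₁ refl = +≤+ (ℕ.s≤s (ℕ.s≤s ℕ.z≤n))

-- Vectors with five entries and their sums.

pattern 𝟎 = zero
pattern 𝟏 = suc zero
pattern 𝟐 = suc (suc zero)
pattern 𝟑 = suc (suc (suc zero))
pattern 𝟒 = suc (suc (suc (suc zero)))

Vec₅ : Set
Vec₅ = Fin 5 → ℤ

∑ : Vec₅ → ℤ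
∑ f = f 𝟎 + f 𝟏 + f 𝟐 + f 𝟑 + f 𝟒

∑-cong : ∀ {f g} → (∀ j → f j ≡ g j) → ∑ f ≡ ∑ g
∑-cong h = cong₂ _+_ (cong₂ _+_ (cong₂ _+_ (cong₂ _+_ (h 𝟎) (h 𝟏)) (h 𝟐)) (h 𝟑)) (h 𝟒)

∑-mono : ∀ {f g} → (∀ j → f j ≤ g j) → ∑ f ≤ ∑ g
∑-mono h = +-mono-≤ (+-mono-≤ (+-mono-≤ (+-mono-≤ (h 𝟎) (h 𝟏)) (h 𝟐)) (h 𝟑)) (h 𝟒)

∑-+ : ∀ f g → ∑ (λ j → f j + g j) ≡ ∑ f + ∑ g
∑-+ f g = lemma (f 𝟎) (f 𝟏) (f 𝟐) (f 𝟑) (f 𝟒) (g 𝟎) (g 𝟏) (g 𝟐) (g 𝟑) (g 𝟒)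
  where
  lemma : ∀ a b c d e a′ b′ c′ d′ e′ →
    a + a′ + (b + b′) + (c + c′) + (d + d′) + (e + e′) ≡ a + b + c + d + e + (a′ + b′ + c′ + d′ + e′)
  lemma = solve-∀

∑-* : ∀ c f → ∑ (λ j → c * f j) ≡ c * ∑ f
∑-* c f = lemma c (f 𝟎) (f 𝟏) (f 𝟐) (f 𝟑) (f 𝟒)
  where
  lemma : ∀ k a b c d e → k * a + k * b + k * c + k * d + k * e ≡ k * (a + b + c + d + e)
  lemma = solve-∀

∑-swap : ∀ (F : Fin 5 → Vec₅) → ∑ (λ j → ∑ (λ i → F j i)) ≡ ∑ (λ i → ∑ (λ j → F j i))
∑-swap F = trans (∑-+ (λ j → F j 𝟎 + F j 𝟏 + F j 𝟐 + F j 𝟑) (λ j → F j 𝟒)) (cong (_+ ∑ (λ j → F j 𝟒))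
          (trans (∑-+ (λ j → F j 𝟎 + F j 𝟏 + F j 𝟐) (λ j → F j 𝟑)) (cong (_+ ∑ (λ j → F j 𝟑))
          (trans (∑-+ (λ j → F j 𝟎 + F j 𝟏) (λ j → F j 𝟐)) (cong (_+ ∑ (λ j → F j 𝟐))
                 (∑-+ (λ j → F j 𝟎) (λ j → F j 𝟏)))))))

abs-∑ : ∀ f → abs (∑ f) ≤ ∑ (λ j → abs (f j))
abs-∑ f = ≤-trans (abs-triangle (f 𝟎 + f 𝟏 + f 𝟐 + f 𝟑) (f 𝟒)) (+-monoˡ-≤ (abs (f 𝟒))
         (≤-trans (abs-triangle (f 𝟎 + f 𝟏 + f 𝟐) (f 𝟑)) (+-monoˡ-≤ (abs (f 𝟑))
         (≤-trans (abs-triangle (f 𝟎 + f 𝟏) (f 𝟐)) (+-monoˡ-≤ (abs (f 𝟐))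
                  (abs-triangle (f 𝟎) (f 𝟏)))))))

_[_]≔_ : Vec₅ → Fin 5 → ℤ → Vec₅
(f [ p ]≔ c) j with j ≟ p
... | yes _ = c
... | no  _ = f j

[]≔-same : ∀ f p c → (f [ p ]≔ c) p ≡ c
[]≔-same f p c with p ≟ p
... | yes _   = refl
... | no  p≢p = contradiction refl p≢p

[]≔-other : ∀ f {p j} c → j ≢ p → (f [ p ]≔ c) j ≡ f j
[]≔-other f {p} {j} c j≢p with j ≟ p
... | yes j≡p = contradiction j≡p j≢p
... | no  _   = refl

∑-[]≔ : ∀ f p c → ∑ (f [ p ]≔ c) ≡ ∑ f + (c - f p)
∑-[]≔ f 𝟎 c = lemma c (f 𝟎) (f 𝟏) (f 𝟐) (f 𝟑) (f 𝟒)
  where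
  lemma : ∀ x a b c d e → x + b + c + d + e ≡ a + b + c + d + e + (x - a)
  lemma = solve-∀
∑-[]≔ f 𝟏 c = lemma c (f 𝟎) (f 𝟏) (f 𝟐) (f 𝟑) (f 𝟒)
  where
  lemma : ∀ x a b c d e → a + x + c + d + e ≡ a + b + c + d + e + (x - b)
  lemma = solve-∀
∑-[]≔ f 𝟐 c = lemma c (f 𝟎) (f 𝟏) (f 𝟐) (f 𝟑) (f 𝟒)
  where
  lemma : ∀ x a b c d e → a + b + x + d + e ≡ a + b + c + d + e + (x - c)
  lemma = solve-∀
∑-[]≔ f 𝟑 c = lemma c (f 𝟎) (f 𝟏) (f 𝟐) (f 𝟑) (f 𝟒)
  where
  lemma : ∀ x a b c d e → a + b + c + x + e ≡ a + b + c + d + e + (x - d)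
  lemma = solve-∀
∑-[]≔ f 𝟒 c = lemma c (f 𝟎) (f 𝟏) (f 𝟐) (f 𝟑) (f 𝟒)
  where
  lemma : ∀ x a b c d e → a + b + c + d + x ≡ a + b + c + d + e + (x - e)
  lemma = solve-∀

∑-mono-except₁ : ∀ {f g} p → (∀ j → j ≢ p → f j ≤ g j) → ∑ f ≤ ∑ g + (f p - g p)
∑-mono-except₁ {f} {g} p h = subst (∑ f ≤_) (∑-[]≔ g p (f p)) (∑-mono f≤g′)
  where
  f≤g′ : ∀ j → f j ≤ (g [ p ]≔ f p) j
  f≤g′ j with j ≟ p
  ... | yes refl = ≤-refl
  ... | no  j≢p  = h j j≢p

∑-mono-except₂ : ∀ {f g} p q → p ≢ q → (∀ j → j ≢ p → j ≢ q → f j ≤ g j) →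
  ∑ f ≤ ∑ g + (f p - g p) + (f q - g q)
∑-mono-except₂ {f} {g} p q p≢q h = subst (∑ f ≤_)
  (cong₂ _+_ (∑-[]≔ g p (f p)) (cong (λ c → f q - c) ([]≔-other g (f p) (p≢q ∘ sym))))
  (∑-mono-except₁ q f≤g′)
  where
  f≤g′ : ∀ j → j ≢ q → f j ≤ (g [ p ]≔ f p) j
  f≤g′ j j≢q with j ≟ p
  ... | yes refl = ≤-refl
  ... | no  j≢p  = h j j≢p j≢q

0≤[]≔0 : ∀ {f} p → (∀ j → 0ℤ ≤ f j) → ∀ j → 0ℤ ≤ (f [ p ]≔ 0ℤ) j
0≤[]≔0 p 0≤f j with j ≟ p
... | yes _ = ≤-refl
... | no  _ = 0≤f j

-- Overwriting the three entries with 0 leaves a nonnegative sum, which is the slack.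
∑-three : ∀ {f} {p q r} → (∀ j → 0ℤ ≤ f j) → q ≢ p → r ≢ p → r ≢ q → f p + f q + f r ≤ ∑ f
∑-three {f} {p} {q} {r} 0≤f q≢p r≢p r≢q = linear (∑-mono (0≤[]≔0 r (0≤[]≔0 q (0≤[]≔0 p 0≤f)))) eq
  where
  f₁ = f [ p ]≔ 0ℤ
  f₂ = f₁ [ q ]≔ 0ℤ
  lemma : ∀ s x y z → s - (x + y + z) ≡ s + (0ℤ - x) + (0ℤ - y) + (0ℤ - z)
  lemma = solve-∀
  f₁q : f₁ q ≡ f q
  f₁q = []≔-other f 0ℤ q≢p
  f₂r : f₂ r ≡ f r
  f₂r = trans ([]≔-other f₁ 0ℤ r≢q) ([]≔-other f 0ℤ r≢p)
  eq : ∑ f - (f p + f q + f r) ≡ ∑ (f₂ [ r ]≔ 0ℤ)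
  eq = sym (trans (∑-[]≔ f₂ r 0ℤ)
           (trans (cong₂ _+_ (∑-[]≔ f₁ q 0ℤ) (cong (λ c → 0ℤ - c) f₂r))
           (trans (cong₂ (λ s c → s + (0ℤ - c) + (0ℤ - f r)) (∑-[]≔ f p 0ℤ) f₁q)
                  (sym (lemma (∑ f) (f p) (f q) (f r))))))

-- The skew matrix of two directed triangles sharing a vertex.

-- The cycles 𝟎 → 𝟐 → 𝟑 → 𝟎 and 𝟏 → 𝟒 → 𝟑 → 𝟏, an edge i → j being recorded as M j i = 1 and M i j = -1.
M : Fin 5 → Fin 5 → ℤ
M 𝟎 𝟐 = -1ℤ
M 𝟎 𝟑 = 1ℤ
M 𝟏 𝟑 = 1ℤ
M 𝟏 𝟒 = -1ℤ
M 𝟐 𝟎 = 1ℤ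
M 𝟐 𝟑 = -1ℤ
M 𝟑 𝟎 = -1ℤ
M 𝟑 𝟏 = -1ℤ
M 𝟑 𝟐 = 1ℤ
M 𝟑 𝟒 = 1ℤ
M 𝟒 𝟏 = 1ℤ
M 𝟒 𝟑 = -1ℤ
M _ _ = 0ℤ

mul : Vec₅ → Vec₅
mul u j = ∑ λ i → M j i * u i

-- Row i of M has 2 + 2 δᵢ nonzero entries.
δ : Vec₅
δ 𝟑 = 1ℤ
δ _ = 0ℤ

trit : ∀ i → ∣ i ∣ ℕ.≤ 1 → IsTrit i
trit +0             _ = null
trit +[1+ 0 ]       _ = plus
trit +[1+ ℕ.suc _ ] (ℕ.s≤s ())
trit -[1+ 0 ]       _ = minus
trit -[1+ ℕ.suc _ ] (ℕ.s≤s ())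

M-trit : ∀ i j → IsTrit (M i j)
M-trit i j = trit (M i j) (toWitness {a? = all? λ i → all? λ j → ∣ M i j ∣ ℕ.≤? 1} tt i j)

M-skew : ∀ i j → M i j ≡ - M j i
M-skew = toWitness {a? = all? λ i → all? λ j → M i j ℤ.≟ - M j i} tt

M-diagonal : ∀ i → M i i ≡ 0ℤ
M-diagonal = toWitness {a? = all? λ i → M i i ℤ.≟ 0ℤ} tt

M-degree : ∀ i → ∑ (λ j → abs (M i j)) ≤ + 2 + + 2 * δ i
M-degree = toWitness {a? = all? λ i → ∑ (λ j → abs (M i j)) ≤? + 2 + + 2 * δ i} tt

M-degree-≤4 : ∀ i → ∑ (λ j → abs (M i j)) ≤ + 4
M-degree-≤4 = toWitness {a? = all? λ i → ∑ (λ j → abs (M i j)) ≤? + 4} tt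

-- Any two vertices of two triangles sharing a vertex have a single common neighbour. This confines
-- a conflict between two coordinates to one place.
M-common : ∀ p q → p ≢ q → ∑ (λ j → abs (M p j * M q j)) ≤ 1ℤ
M-common = toWitness {a? = all? λ p → all? λ q → ¬? (p ≟ q) →-dec (∑ (λ j → abs (M p j * M q j)) ≤? 1ℤ)} tt

0≤δ : ∀ j → 0ℤ ≤ δ j
0≤δ = toWitness {a? = all? λ j → 0ℤ ≤? δ j} tt

δ≤1 : ∀ j → δ j ≤ 1ℤ
δ≤1 = toWitness {a? = all? λ j → δ j ≤? 1ℤ} tt

mul-+ : ∀ u v j → mul (λ i → u i + v i) j ≡ mul u j + mul v j
mul-+ u v j = trans (∑-cong λ i → *-distribˡ-+ (M j i) (u i) (v i)) (∑-+ (λ i → M j i * u i)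
  (λ i → M j i * v i))

-- The terms cancel in pairs by skewness. The rows of `M` are written out below so that the ring
-- solver sees their entries.
mul-isotropic : ∀ u → ∑ (λ j → u j * mul u j) ≡ 0ℤ
mul-isotropic u = lemma (u 𝟎) (u 𝟏) (u 𝟐) (u 𝟑) (u 𝟒)
  where
  lemma : ∀ a b c d e →
      a * (0ℤ * a + 0ℤ * b + -1ℤ * c + 1ℤ * d + 0ℤ * e)
    + b * (0ℤ * a + 0ℤ * b + 0ℤ * c + 1ℤ * d + -1ℤ * e)
    + c * (1ℤ * a + 0ℤ * b + 0ℤ * c + -1ℤ * d + 0ℤ * e)
    + d * (-1ℤ * a + -1ℤ * b + 1ℤ * c + 0ℤ * d + 1ℤ * e)
    + e * (0ℤ * a + 1ℤ * b + 0ℤ * c + -1ℤ * d + 0ℤ * e) ≡ 0ℤ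
  lemma = solve-∀

-- The edges form directed cycles, so each vertex has as many edges in as out and every row of `M`
-- sums to zero.
mul-const : ∀ j → mul (λ _ → 1ℤ) j ≡ 0ℤ
mul-const = toWitness {a? = all? λ j → mul (λ _ → 1ℤ) j ℤ.≟ 0ℤ} tt

mul-shift : ∀ u s j → mul (λ i → u i + s) j ≡ mul u j
mul-shift u s j = trans (mul-+ u (λ _ → s) j) (trans (cong (λ c → mul u j + c)
  (trans (∑-cong λ i → lemma s (M j i)) (trans (∑-* s (λ i → M j i * 1ℤ)) (trans (cong (s *_) (mul-const j))
    (*-zeroʳ s))))) (+-identityʳ (mul u j)))
  where
  lemma : ∀ s c → c * s ≡ s * (c * 1ℤ)
  lemma = solve-∀

mul-neg : ∀ u j → mul (λ i → - u i) j ≡ - mul u j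
mul-neg u j = trans (∑-cong λ i → lemma (M j i) (u i)) (trans (∑-* -1ℤ (λ i → M j i * u i)) (-1*i≡-i (mul u j)))
  where
  lemma : ∀ c s → c * - s ≡ -1ℤ * (c * s)
  lemma = solve-∀

axis : Fin 5 → ℤ → Vec₅
axis p e = (λ _ → 0ℤ) [ p ]≔ e

mul-axis : ∀ p e j → mul (axis p e) j ≡ M j p * e
mul-axis p e j = trans (∑-cong pointwise) (trans (∑-[]≔ (λ _ → 0ℤ) p (M j p * e)) (lemma (M j p * e)))
  where
  lemma : ∀ i → 0ℤ + (i - 0ℤ) ≡ i
  lemma = solve-∀
  pointwise : ∀ i → M j i * axis p e i ≡ axis p (M j p * e) i
  pointwise i with i ≟ p
  ... | yes refl = refl
  ... | no  _    = *-zeroʳ (M j i)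

-- Meant for signs: `1 + 2 * half e` recovers `e`, so a sign vector has lattice coordinates `t = 1`
-- and `u = half ∘ ε`.
half : ℤ → ℤ
half (+ _)    = 0ℤ
half -[1+ _ ] = -1ℤ

half-unit : ∀ {e} → IsUnit e → e ≡ 1ℤ + + 2 * half e
half-unit plus  = refl
half-unit minus = refl

halve-≤ : ∀ {i j} → + 2 * i ≤ + 2 * j → i ≤ j
halve-≤ {i} {j} = *-cancelˡ-≤-pos i j (+ 2)

-- The constant part of `1 + 2 * half ε` is annihilated, which makes ½ M ε integral.
mul-half : ∀ ε → (∀ j → IsUnit (ε j)) → ∀ j → mul ε j ≡ + 2 * mul (half ∘ ε) j
mul-half ε ε-unit j = trans (∑-cong λ i → trans (cong (M j i *_) (half-unit (ε-unit i)))
  (lemma (M j i) (half (ε i))))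
  (trans (∑-+ (λ i → M j i * 1ℤ) (λ i → + 2 * (M j i * half (ε i))))
  (trans (cong₂ _+_ (mul-const j) (∑-* (+ 2) (λ i → M j i * half (ε i)))) (+-identityˡ _)))
  where
  lemma : ∀ c h → c * (1ℤ + + 2 * h) ≡ c * 1ℤ + + 2 * (c * h)
  lemma = solve-∀

-- ½ εⱼ (M ε)ⱼ, computed as εⱼ (M u)ⱼ with ε = 1 + 2u, since M annihilates constant vectors.
excess : Vec₅ → Vec₅
excess ε j = ε j * mul (half ∘ ε) j

2*excess : ∀ ε → (∀ j → IsUnit (ε j)) → ∀ j → + 2 * excess ε j ≡ ε j * mul ε j
2*excess ε ε-unit j = trans (lemma (ε j) _) (cong (ε j *_) (sym (mul-half ε ε-unit j)))
  where
  lemma : ∀ e h → + 2 * (e * h) ≡ e * (+ 2 * h)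
  lemma = solve-∀

-- Twice this sum is the quadratic form of a skew matrix. Hence all corners a ε + ½ M ε with
-- nonnegative `a + excess ε j` have the same norm 5a.
∑-excess : ∀ ε → (∀ j → IsUnit (ε j)) → ∑ (excess ε) ≡ 0ℤ
∑-excess ε ε-unit = *-cancelˡ-≡ (+ 2) (∑ (excess ε)) 0ℤ
  (trans (sym (∑-* (+ 2) (excess ε))) (trans (∑-cong (2*excess ε ε-unit)) (mul-isotropic ε)))

-- Each nonzero entry of row `j` contributes at least -1 to `εⱼ (M ε)ⱼ`; halving the row bound
-- `2 + 2 δⱼ` gives `1 + δⱼ`.
excess-≥ : ∀ ε → (∀ j → IsUnit (ε j)) → ∀ j → 0ℤ ≤ 1ℤ + δ j + excess ε j
excess-≥ ε ε-unit j = halve-≤ (linear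
  (slack (M-degree j) ⊕ slack (∑-mono pointwise))
  (trans (lemma₁ (δ j) (excess ε j)) (trans (cong (λ d → + 2 + + 2 * δ j + d) (2*excess ε ε-unit j))
    (trans (lemma₂ (+ 2 + + 2 * δ j) (∑ λ i → abs (M j i)) (ε j) (mul ε j))
       (cong (λ s → (+ 2 + + 2 * δ j - ∑ λ i → abs (M j i)) + ((∑ λ i → abs (M j i)) - s))
         (sym (∑-* (- ε j) (λ i → M j i * ε i))))))))
  where
  pointwise : ∀ i → - ε j * (M j i * ε i) ≤ abs (M j i)
  pointwise i = subst (- ε j * (M j i * ε i) ≤_)
    (trans (abs-neg* (ε j) _) (trans (abs-unit* (ε-unit j) _) (abs-*-unit (ε-unit i) (M j i))))
      (i≤abs (- ε j * (M j i * ε i)))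
    where
    abs-neg* : ∀ e i → abs (- e * i) ≡ abs (e * i)
    abs-neg* e i = trans (cong abs (sym (neg-distribˡ-* e i))) (abs-neg (e * i))
  lemma₁ : ∀ d x → + 2 * (1ℤ + d + x) - + 2 * 0ℤ ≡ + 2 + + 2 * d + + 2 * x
  lemma₁ = solve-∀
  lemma₂ : ∀ x s e m → x + e * m ≡ (x - s) + (s - - e * m)
  lemma₂ = solve-∀

-- The norm and the lattice.

‖_‖ : Vec₅ → ℤ
‖ x ‖ = ∑ (λ j → abs (x j))

abs-below : ∀ {e i y c z} → IsUnit e → i ≡ e * y → z ≡ e * c → y ≤ c → abs (i - z) ≡ c - y
abs-below {e} {_} {y} {c} e-unit refl refl y≤c =
  trans (abs-sym (e * y) (e * c)) (trans (cong abs (lemma e c y)) (trans (abs-unit* e-unit (c - y))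
    (0≤i⇒+∣i∣≡i (slack y≤c))))
  where
  lemma : ∀ e c y → e * c - e * y ≡ e * (c - y)
  lemma = solve-∀

-- This is a s + ½ M s for s = t + 2u.
lattice : ℤ → ℤ → Vec₅ → Vec₅
lattice a t u j = t * a + + 2 * a * u j + mul u j

-- Shortening a vector of norm `k + 1`: the available lattice vectors.

module Reduction (a k : ℤ) (5≤a : + 5 ≤ a) (5a≡2k+1 : + 5 * a ≡ + 2 * k + 1ℤ)
                 (x : Vec₅) (‖x‖≡1+k : ‖ x ‖ ≡ 1ℤ + k) where

  Reducible : Set
  Reducible = Σ ℤ λ t → Σ Vec₅ λ u → ‖ (λ j → x j - lattice a t u j) ‖ ≤ k

  y : Vec₅
  y j = abs (x j)

  -- No coordinate passes the corner, so the distance to it is a difference of norms,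
  -- `5a - (1 + k) = k`.
  reduce-corner : ∀ ε → (∀ j → IsUnit (ε j)) → (∀ j → x j ≡ ε j * y j) →
    (∀ j → y j ≤ a + excess ε j) → Reducible
  reduce-corner ε ε-unit x≡εy y≤ = 1ℤ , half ∘ ε , ≤-reflexive
    (trans (∑-cong λ j → abs-below (ε-unit j) (x≡εy j) (corner j) (y≤ j))
    (trans (lemma₁ a (excess ε 𝟎) (excess ε 𝟏) (excess ε 𝟐) (excess ε 𝟑) (excess ε 𝟒) (y 𝟎) (y 𝟏) (y 𝟐) (y 𝟑)
      (y 𝟒))
    (trans (cong₂ (λ s t → + 5 * a + s - t) (∑-excess ε ε-unit) ‖x‖≡1+k)
    (trans (cong (λ s → s + 0ℤ - (1ℤ + k)) 5a≡2k+1) (lemma₂ k)))))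
    where
    lemma₁ : ∀ a d₀ d₁ d₂ d₃ d₄ y₀ y₁ y₂ y₃ y₄ →
      a + d₀ - y₀ + (a + d₁ - y₁) + (a + d₂ - y₂) + (a + d₃ - y₃) + (a + d₄ - y₄) ≡
      + 5 * a + (d₀ + d₁ + d₂ + d₃ + d₄) - (y₀ + y₁ + y₂ + y₃ + y₄)
    lemma₁ = solve-∀
    lemma₂ : ∀ k → + 2 * k + 1ℤ + 0ℤ - (1ℤ + k) ≡ k
    lemma₂ = solve-∀
    lemma₃ : ∀ a h m → 1ℤ * a + + 2 * a * h + m ≡ (1ℤ + + 2 * h) * a + 1ℤ * m
    lemma₃ = solve-∀
    lemma₄ : ∀ e a m → e * a + e * e * m ≡ e * (a + e * m)
    lemma₄ = solve-∀
    corner : ∀ j → lattice a 1ℤ (half ∘ ε) j ≡ ε j * (a + excess ε j)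
    -- The factor `ε j * ε j = 1` is inserted before the `mul` term so that `ε j` can be taken out
    -- of the sum.
    corner j = trans (lemma₃ a (half (ε j)) (mul (half ∘ ε) j))
      (trans (cong₂ (λ e f → e * a + f * mul (half ∘ ε) j) (sym (half-unit (ε-unit j)))
        (sym (unit² (ε-unit j))))
             (lemma₄ (ε j) a (mul (half ∘ ε) j)))

  σ : Vec₅
  σ j = pick (x j) 0ℤ 0ℤ

  σ-unit : ∀ j → IsUnit (σ j)
  σ-unit j = pick-unit (x j) null null

  x≡σy : ∀ j → x j ≡ σ j * y j
  x≡σy j = pick-sign (x j) 0ℤ 0ℤ

  -- What subtracting the lattice vector near 2a σₚ eₚ adds to `x j` for `j ≠ p`: the sign of
  -- `M j p = - M p j` cancels that of the subtraction.
  row : Fin 5 → Vec₅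
  row p j = σ p * M p j

  row-trit : ∀ p j → IsTrit (row p j)
  row-trit p j = unit*trit (σ-unit p) (M-trit p j)

  row-diagonal : ∀ p → row p p ≡ 0ℤ
  row-diagonal p = trans (cong (σ p *_) (M-diagonal p)) (*-zeroʳ (σ p))

  -- The change of norm of x, outside coordinate p, under subtraction of the lattice vector near 2a σₚ eₚ.
  β : Vec₅
  β p = ∑ λ j → shift (x j) (row p j)

  β≤4 : ∀ p → β p ≤ + 4
  β≤4 p = ≤-trans (∑-mono λ j → subst (shift (x j) (row p j) ≤_) (abs-unit* (σ-unit p) (M p j))
    (shift-≤ (x j) (row p j))) (M-degree-≤4 p)

  -- Coordinate `p` has to drop by at least `1 + β p` to make up for the others and reach `k`. If it
  -- stays on its side of `2a`, it drops by `2a`, which suffices as `a ≥ 5` and `β p ≤ 4`; otherwise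
  -- it drops by `2 y p - 2a`, and `far` is what is needed.
  reduce-axis : ∀ p → 1ℤ + (+ 2 * a + β p) ≤ + 2 * y p → Reducible
  reduce-axis p far = 0ℤ , axis p (σ p) , ≤-trans (∑-mono-except₁ {g = g} p f≤g)
    (linear (slack fp≤) (trans (cong (λ s → k - (s + (f p - g p))) ∑g)
      (trans (cong (λ s → k - (1ℤ + k + β p + (f p - s))) gp) (lemma₁ k (β p) (f p) (y p)))))
    where
    f g : Vec₅
    f j = abs (x j - lattice a 0ℤ (axis p (σ p)) j)
    g j = abs (x j + row p j)
    lemma₁ : ∀ k b f y → k - (1ℤ + k + b + (f - y)) ≡ y - b - 1ℤ - f
    lemma₁ = solve-∀
    lemma₂ : ∀ x a m s → x - (0ℤ * a + + 2 * a * 0ℤ + - m * s) ≡ x + s * m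
    lemma₂ = solve-∀
    f≤g : ∀ j → j ≢ p → f j ≤ g j
    f≤g j j≢p = ≤-reflexive (cong abs (trans
      (cong₂ (λ s t → x j - (0ℤ * a + + 2 * a * s + t)) ([]≔-other (λ _ → 0ℤ) (σ p) j≢p)
             (trans (mul-axis p (σ p) j) (cong (_* σ p) (M-skew j p))))
      (lemma₂ (x j) a (M p j) (σ p))))
    gp : g p ≡ y p
    gp = cong abs (trans (cong (λ m → x p + m) (row-diagonal p)) (+-identityʳ (x p)))
    lemma₃ : ∀ s t → s ≡ t + (s - t)
    lemma₃ = solve-∀
    ∑g : ∑ g ≡ 1ℤ + k + β p
    ∑g = trans (∑-cong {f = g} {g = λ j → abs (x j) + shift (x j) (row p j)} λ j → lemma₃ (g j) (abs (x j)))
         (trans (∑-+ (λ j → abs (x j)) (λ j → shift (x j) (row p j))) (cong (_+ β p) ‖x‖≡1+k))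
    lemma₄ : ∀ s y a → s * y - (0ℤ * a + + 2 * a * s + 0ℤ * s) ≡ s * (y - + 2 * a)
    lemma₄ = solve-∀
    fp : f p ≡ abs (y p - + 2 * a)
    fp = trans (cong abs (trans
      (cong₂ _-_ (x≡σy p) (cong₂ (λ s t → 0ℤ * a + + 2 * a * s + t) ([]≔-same (λ _ → 0ℤ) p (σ p))
             (trans (mul-axis p (σ p) p) (cong (_* σ p) (M-diagonal p)))))
      (lemma₄ (σ p) (y p) a))) (abs-unit* (σ-unit p) _)
    lemma₅ : ∀ y b a → y - b - 1ℤ - (y - + 2 * a) ≡ + 4 - b + (a - + 5) + (a - + 5) + + 5
    lemma₅ = solve-∀
    lemma₆ : ∀ y b a → y - b - 1ℤ - - (y - + 2 * a) ≡ + 2 * y - (1ℤ + (+ 2 * a + b))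
    lemma₆ = solve-∀
    fp≤ : f p ≤ y p - β p - 1ℤ
    fp≤ = subst (_≤ y p - β p - 1ℤ) (sym fp) (abs-≤
      (linear (slack (β≤4 p) ⊕ slack 5≤a ⊕ slack 5≤a ⊕ +≤+ ℕ.z≤n) (lemma₅ (y p) (β p) a))
      (linear (slack far) (lemma₆ (y p) (β p) a)))

  -- Signs of x that suit coordinate p, and coordinate q as far as p leaves them free.
  favour : Fin 5 → Fin 5 → Vec₅
  favour p q j = pick (x j) (row p j) (row q j)

  favour-unit : ∀ p q j → IsUnit (favour p q j)
  favour-unit p q j = pick-unit (x j) (row-trit p j) (row-trit q j)

  favour-nonzero : ∀ p q r → 1ℤ ≤ y r → favour p q r ≡ σ r
  favour-nonzero p q r = pick-nonzero (row p r) (row q r) 0ℤ 0ℤ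

  -- A nonzero coordinate has the sign `σ r` under every choice, so row `r` of `M` signed by
  -- `favour p q` agrees with `row r`.
  2*excess-favour : ∀ p q r → 1ℤ ≤ y r → + 2 * excess (favour p q) r ≡ ∑ λ j → row r j * favour p q j
  2*excess-favour p q r 1≤y = trans (2*excess (favour p q) (favour-unit p q) r)
    (trans (sym (∑-* (favour p q r) (λ j → M r j * favour p q j)))
    (∑-cong λ j → trans (cong (_* (M r j * favour p q j)) (favour-nonzero p q r 1≤y))
      (sym (*-assoc (σ r) (M r j) (favour p q j)))))

  -- All free signs go to `p` first, so `shift-favoured` gives equality term by term.
  excess-favoured : ∀ p q → 1ℤ ≤ y p → + 2 * excess (favour p q) p ≡ β p
  excess-favoured p q 1≤y = trans (2*excess-favour p q p 1≤y)
    (∑-cong λ j → sym (shift-favoured (x j) (row-trit p j) (row-trit q j)))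

  ∑-common-≤1 : ∀ p q → p ≢ q → ∑ (λ j → abs (row p j * row q j)) ≤ 1ℤ
  ∑-common-≤1 p q p≢q = subst (_≤ 1ℤ) (∑-cong λ j → sym (pointwise j)) (M-common p q p≢q)
    where
    lemma : ∀ s m s′ m′ → s * m * (s′ * m′) ≡ s * (s′ * (m * m′))
    lemma = solve-∀
    pointwise : ∀ j → abs (row p j * row q j) ≡ abs (M p j * M q j)
    pointwise j = trans (cong abs (lemma (σ p) (M p j) (σ q) (M q j)))
      (trans (abs-unit* (σ-unit p) _) (abs-unit* (σ-unit q) _))

  -- By `shift-other` a term loses 2 only at a common neighbour of `p` and `q`, hence at most once.
  excess-other : ∀ p q → p ≢ q → 1ℤ ≤ y q → β q - + 2 ≤ + 2 * excess (favour p q) q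
  excess-other p q p≢q 1≤y = subst (β q - + 2 ≤_) (sym (2*excess-favour p q q 1≤y))
    (≤-trans (linear (slack (∑-common-≤1 p q p≢q) ⊕ slack (∑-common-≤1 p q p≢q))
      (trans (cong (_- (β q - + 2)) ∑-lower) (lemma₁ (β q) (∑ λ j → abs (row p j * row q j)))))
      (∑-mono λ j → shift-other (x j) (row-trit p j) (row-trit q j)))
    where
    lemma₁ : ∀ b s → b + - + 2 * s - (b - + 2) ≡ 1ℤ - s + (1ℤ - s)
    lemma₁ = solve-∀
    lemma₂ : ∀ b s → b - + 2 * s ≡ b + - + 2 * s
    lemma₂ = solve-∀
    ∑-lower : ∑ (λ j → shift (x j) (row q j) - + 2 * abs (row p j * row q j))
      ≡ β q + - + 2 * ∑ (λ j → abs (row p j * row q j))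
    ∑-lower = trans (∑-cong λ j → lemma₂ (shift (x j) (row q j)) (abs (row p j * row q j)))
      (trans (∑-+ (λ j → shift (x j) (row q j)) (λ j → - + 2 * abs (row p j * row q j)))
             (cong (λ s → β q + s) (∑-* (- + 2) (λ j → abs (row p j * row q j)))))

  -- Uses the lattice vector near 2a (σₚ eₚ + σ_q e_q). The first two bounds on `y` keep both
  -- coordinates from passing their targets; the last two are what remains when neither choice of
  -- free signs gives a usable corner.
  reduce-plane : ∀ p q → p ≢ q → 1ℤ ≤ y p → 1ℤ ≤ y q →
    + 2 * y p ≤ + 2 * a + β p → + 2 * y q ≤ + 2 * a + β q →
    + 2 * a + β p ≤ + 2 * y p → 1ℤ + (a + excess (favour p q) q) ≤ y q → Reducible
  reduce-plane p q p≢q 1≤yp 1≤yq yp≤ yq≤ ≤yp ≤yq = 0ℤ , u , ≤-trans (∑-mono-except₂ {f = f} {g = g} p q p≢q f≤g)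
    (linear (slack ≤yp ⊕ slack ≤yq ⊕ slack ≤yq ⊕ slack ≤yq ⊕ slack ≤yq ⊕ slack yq≤ ⊕ slack (∑-common-≤1 p q p≢q)
      ⊕ slack (∑-common-≤1 p q p≢q) ⊕ +≤+ (ℕ.z≤n {1}))
      (trans (cong (λ s → k - (s + (f p - g p) + (f q - g q))) ∑g)
      (trans (cong₂ (λ s s′ → k - (1ℤ + k + (β p + + 2 * (+ 2 * E) + - 1ℤ * β q + + 2 * common) + s + s′))
        (cong₂ _-_ fp gp) (cong₂ _-_ fq gq))
             (lemma₁ k (β p) (β q) E common a (y p) (y q) t))))
    where
    E = excess (favour p q) q
    common = ∑ λ j → abs (row p j * row q j)
    -- The interaction of `p` and `q` through `M`. By skewness it enters the two coordinates with
    -- opposite signs and cancels from the total.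
    t = row p q * σ q
    u f g g′ : Vec₅
    u i = axis p (σ p) i + axis q (σ q) i
    f j = abs (x j - lattice a 0ℤ u j)
    -- The bound of `shift₂`. Its terms are chosen so that the sum over all `j` is
    -- `β p + 4 E - β q + 2 common`, which brings in the failure of the corner at `q` through `E`.
    g′ j = shift (x j) (row p j) + + 2 * (row q j * favour p q j) - shift (x j) (row q j)
      + + 2 * abs (row p j * row q j)
    g j = y j + g′ j
    lemma₁ : ∀ k b b′ e c a y y′ t →
      k - (1ℤ + k + (b + + 2 * (+ 2 * e) + - 1ℤ * b′ + + 2 * c) + (+ 2 * a + t - y - (y - t))
        + (+ 2 * a - t - y′ - (y′ + t))) ≡
      + 2 * y - (+ 2 * a + b) + (y′ - (1ℤ + (a + e))) + (y′ - (1ℤ + (a + e))) + (y′ - (1ℤ + (a + e)))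
        + (y′ - (1ℤ + (a + e)))
        + (+ 2 * a + b′ - + 2 * y′) + (1ℤ - c) + (1ℤ - c) + 1ℤ
    lemma₁ = solve-∀
    lemma₂ : ∀ s v s′ c → s + + 2 * v - s′ + + 2 * c ≡ s + + 2 * v + - 1ℤ * s′ + + 2 * c
    lemma₂ = solve-∀
    ∑g : ∑ g ≡ 1ℤ + k + (β p + + 2 * (+ 2 * E) + - 1ℤ * β q + + 2 * common)
    ∑g = trans (∑-+ y g′) (cong₂ _+_ ‖x‖≡1+k
      (trans (∑-cong λ j → lemma₂ (shift (x j) (row p j)) (row q j * favour p q j) (shift (x j) (row q j))
        (abs (row p j * row q j)))
      (trans (∑-+ (λ j → shift (x j) (row p j) + + 2 * (row q j * favour p q j) + - 1ℤ * shift (x j) (row q j))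
        (λ j → + 2 * abs (row p j * row q j)))
      (cong₂ _+_
        (trans (∑-+ (λ j → shift (x j) (row p j) + + 2 * (row q j * favour p q j)) (λ j → - 1ℤ * shift (x j)
          (row q j)))
        (cong₂ _+_
          (trans (∑-+ (λ j → shift (x j) (row p j)) (λ j → + 2 * (row q j * favour p q j)))
            (cong (λ s → β p + s) (trans (∑-* (+ 2) (λ j → row q j * favour p q j))
              (cong (+ 2 *_) (sym (2*excess-favour p q q 1≤yq))))))
          (∑-* (- 1ℤ) (λ j → shift (x j) (row q j)))))
        (∑-* (+ 2) (λ j → abs (row p j * row q j)))))))
    mul-u : ∀ j → mul u j ≡ M j p * σ p + M j q * σ q
    mul-u j = trans (mul-+ (axis p (σ p)) (axis q (σ q)) j) (cong₂ _+_ (mul-axis p (σ p) j)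
      (mul-axis q (σ q) j))
    lemma₃ : ∀ x a m s m′ s′ → x - (0ℤ * a + + 2 * a * (0ℤ + 0ℤ) + (- m * s + - m′ * s′))
      ≡ x + (s * m + s′ * m′)
    lemma₃ = solve-∀
    f≤g : ∀ j → j ≢ p → j ≢ q → f j ≤ g j
    f≤g j j≢p j≢q = subst (_≤ g j)
      (cong abs (sym (trans (cong₂ (λ s s′ → x j - (0ℤ * a + + 2 * a * s + s′))
          (cong₂ _+_ ([]≔-other (λ _ → 0ℤ) (σ p) j≢p) ([]≔-other (λ _ → 0ℤ) (σ q) j≢q))
          (trans (mul-u j) (cong₂ (λ m m′ → m * σ p + m′ * σ q) (M-skew j p) (M-skew j q))))
        (lemma₃ (x j) a (M p j) (σ p) (M q j) (σ q)))))
      (shift₂ (x j) (row-trit p j) (row-trit q j))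
    t-trit : IsTrit t
    t-trit = subst IsTrit (*-comm (σ q) (row p q)) (unit*trit (σ-unit q) (row-trit p q))
    -- From `β r ≤ 4` and `a ≥ 5` follows `y r ≤ a + 2 < 2a - 1`, which leaves room for any trit.
    room : ∀ {r s} → + 2 * y r ≤ + 2 * a + β r → IsTrit s → y r ≤ + 2 * a + s
    room {r} {s} yr≤ s-trit = halve-≤ (linear (slack yr≤ ⊕ slack (β≤4 r) ⊕ slack 5≤a ⊕ slack 5≤a
      ⊕ 0≤1+trit s-trit ⊕ 0≤1+trit s-trit ⊕ +≤+ (ℕ.z≤n {4})) (lemma₄ (y r) a (β r) s))
      where
      lemma₄ : ∀ y a b s → + 2 * (+ 2 * a + s) - + 2 * y ≡ + 2 * a + b - + 2 * y + (+ 4 - b) + (a - + 5)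
        + (a - + 5) + (1ℤ + s) + (1ℤ + s) + + 4
      lemma₄ = solve-∀
    row-skew : row q p * σ p ≡ - t
    row-skew = trans (cong (λ m → σ q * m * σ p) (M-skew q p)) (lemma (σ p) (σ q) (M p q))
      where
      lemma : ∀ s s′ m → s′ * - m * s ≡ - (s * m * s′)
      lemma = solve-∀
    insert-unit² : ∀ r i → i ≡ σ r * σ r * i
    insert-unit² r i = trans (sym (*-identityˡ i)) (cong (_* i) (sym (unit² (σ-unit r))))
    fp : f p ≡ + 2 * a + t - y p
    fp = abs-below (σ-unit p) (x≡σy p)
      (trans (cong₂ (λ s s′ → 0ℤ * a + + 2 * a * s + s′)
          (cong₂ _+_ ([]≔-same (λ _ → 0ℤ) p (σ p)) ([]≔-other (λ _ → 0ℤ) (σ q) p≢q))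
          (trans (mul-u p) (cong₂ (λ m c → m * σ p + c) (M-diagonal p) (insert-unit² p (M p q * σ q)))))
        (lemma (σ p) (σ q) (M p q) a))
      (room {p} yp≤ t-trit)
      where
      lemma : ∀ s s′ m a → 0ℤ * a + + 2 * a * (s + 0ℤ) + (0ℤ * s + s * s * (m * s′))
        ≡ s * (+ 2 * a + s * m * s′)
      lemma = solve-∀
    fq : f q ≡ + 2 * a - t - y q
    fq = abs-below (σ-unit q) (x≡σy q)
      (trans (cong₂ (λ s s′ → 0ℤ * a + + 2 * a * s + s′)
          (cong₂ _+_ ([]≔-other (λ _ → 0ℤ) (σ p) (p≢q ∘ sym)) ([]≔-same (λ _ → 0ℤ) q (σ q)))
          (trans (mul-u q) (cong₂ (λ c m → c + m * σ q) (insert-unit² q (M q p * σ p)) (M-diagonal q))))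
        (trans (lemma (σ q) (σ p) (M q p) a) (cong (λ c → σ q * (+ 2 * a + c)) row-skew)))
      (room {q} yq≤ (neg-trit t-trit))
      where
      lemma : ∀ s s′ m a → 0ℤ * a + + 2 * a * (0ℤ + s) + (s * s * (m * s′) + 0ℤ * s)
        ≡ s * (+ 2 * a + s * m * s′)
      lemma = solve-∀
    shift-σ : ∀ r {c} → 1ℤ ≤ y r → IsTrit c → shift (x r) c ≡ c * σ r
    shift-σ r 1≤y c-trit = shift-pick (x r) null null c-trit 1≤y
    gp : g p ≡ y p - t
    gp = cong (λ s → y p + s) (trans
      (cong₂ (λ s s′ → s + + 2 * (row q p * favour p q p) - s′ + + 2 * abs (row p p * row q p))
        (shift-σ p 1≤yp (row-trit p p)) (shift-σ p 1≤yp (row-trit q p)))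
      (trans (cong₂ (λ s s′ → s * σ p + + 2 * (row q p * s′) - row q p * σ p + + 2 * abs (s * row q p))
        (row-diagonal p) (favour-nonzero p q p 1≤yp))
      (trans (lemma (row q p) (σ p)) row-skew)))
      where
      lemma : ∀ c s → 0ℤ * s + + 2 * (c * s) - c * s + 0ℤ ≡ c * s
      lemma = solve-∀
    gq : g q ≡ y q + t
    gq = cong (λ s → y q + s) (trans
      (cong₂ (λ s s′ → s + + 2 * (row q q * favour p q q) - s′ + + 2 * abs (row p q * row q q))
        (shift-σ q 1≤yq (row-trit p q)) (shift-σ q 1≤yq (row-trit q q)))
      (trans (cong (λ c → row p q * σ q + + 2 * (c * favour p q q) - c * σ q + + 2 * abs (row p q * c))
        (row-diagonal q))
      (trans (cong (λ c → row p q * σ q + + 2 * (0ℤ * favour p q q) - 0ℤ * σ q + + 2 * abs c)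
        (*-zeroʳ (row p q))) (lemma t (favour p q q) (σ q)))))
      where
      lemma : ∀ c f s → c + + 2 * (0ℤ * f) - 0ℤ * s + 0ℤ ≡ c
      lemma = solve-∀

  -- Shortening a vector of norm `k + 1`: cases by the number of large coordinates.

  -- The threshold is set by `excess-≥`: a coordinate that is not heavy satisfies
  -- `y j ≤ a - 1 - δ j` and so lies below the corner for every sign vector.
  Heavy : Fin 5 → Set
  Heavy j = a ≤ y j + δ j

  heavy? : ∀ j → Dec (Heavy j)
  heavy? j = a ≤? y j + δ j

  heavy-nonzero : ∀ {j} → Heavy j → 1ℤ ≤ y j
  heavy-nonzero {j} heavy = linear (slack heavy ⊕ slack 5≤a ⊕ slack (δ≤1 j) ⊕ +≤+ (ℕ.z≤n {3}))
    (lemma (y j) a (δ j))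
    where
    lemma : ∀ y a d → y - 1ℤ ≡ y + d - a + (a - + 5) + (1ℤ - d) + + 3
    lemma = solve-∀

  light-≤ : ∀ ε → (∀ j → IsUnit (ε j)) → ∀ {j} → ¬ Heavy j → y j ≤ a + excess ε j
  light-≤ ε ε-unit {j} light = linear (slack (≰⇒suc≤ light) ⊕ excess-≥ ε ε-unit j)
    (lemma (y j) a (δ j) (excess ε j))
    where
    lemma : ∀ y a d e → a + e - y ≡ a - (1ℤ + (y + d)) + (1ℤ + d + e)
    lemma = solve-∀

  -- As `δ` sums to 1, three heavy coordinates would give `3a ≤ k + 2`. Doubling and using
  -- `5a = 2k + 1` yields `a ≤ 3`, against `a ≥ 5`.
  third-light : ∀ {p q r} → Heavy p → Heavy q → q ≢ p → r ≢ p → r ≢ q → ¬ Heavy r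
  third-light {p} {q} {r} hp hq q≢p r≢p r≢q hr = contradiction
    (linear {0ℤ} { -1ℤ} (slack hp ⊕ slack hp ⊕ slack hq ⊕ slack hq ⊕ slack hr ⊕ slack hr
      ⊕ slack three ⊕ slack three ⊕ slack (≤-reflexive (sym 5a≡2k+1)) ⊕ slack 5≤a ⊕ +≤+ (ℕ.z≤n {1}))
      (lemma a (z p) (z q) (z r) k)) λ ()
    where
    z : Vec₅
    z j = y j + δ j
    three : z p + z q + z r ≤ 1ℤ + k + 1ℤ
    three = subst (z p + z q + z r ≤_) (trans (∑-+ y δ) (cong (_+ 1ℤ) ‖x‖≡1+k))
      (∑-three (λ j → 0≤abs (x j) ⊕ 0≤δ j) q≢p r≢p r≢q)
    lemma : ∀ a x y z k → -1ℤ - 0ℤ ≡ x - a + (x - a) + (y - a) + (y - a) + (z - a) + (z - a)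
      + (1ℤ + k + 1ℤ - (x + y + z)) + (1ℤ + k + 1ℤ - (x + y + z)) + (+ 5 * a - (+ 2 * k + 1ℤ)) + (a - + 5) + 1ℤ
    lemma = solve-∀

  reduce-favour : ∀ p q → y p ≤ a + excess (favour p q) p → y q ≤ a + excess (favour p q) q →
    (∀ j → j ≢ p → j ≢ q → ¬ Heavy j) → Reducible
  reduce-favour p q yp≤ yq≤ light = reduce-corner (favour p q) (favour-unit p q)
    (λ j → pick-sign (x j) (row p j) (row q j)) bound
    where
    bound : ∀ j → y j ≤ a + excess (favour p q) j
    bound j with j ≟ p | j ≟ q
    ... | yes refl | _        = yp≤
    ... | no  _    | yes refl = yq≤
    ... | no  j≢p  | no  j≢q  = light-≤ (favour p q) (favour-unit p q) (light j j≢p j≢q)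

  favoured-≤ : ∀ p q → 1ℤ ≤ y p → + 2 * y p ≤ + 2 * a + β p → y p ≤ a + excess (favour p q) p
  favoured-≤ p q 1≤y yp≤ = halve-≤ (subst (+ 2 * y p ≤_)
    (trans (cong (λ b → + 2 * a + b) (sym (excess-favoured p q 1≤y)))
      (sym (*-distribˡ-+ (+ 2) a (excess (favour p q) p)))) yp≤)

  reduce-two : ∀ {p q} → Heavy p → Heavy q → q ≢ p →
    + 2 * y p ≤ + 2 * a + β p → + 2 * y q ≤ + 2 * a + β q → Reducible
  reduce-two {p} {q} hp hq q≢p yp≤ yq≤
    with y q ≤? a + excess (favour p q) q | y p ≤? a + excess (favour q p) p
  ... | yes yq≤′ | _ = reduce-favour p q (favoured-≤ p q (heavy-nonzero hp) yp≤) yq≤′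
    (λ j j≢p j≢q → third-light hp hq q≢p j≢p j≢q)
  ... | no _ | yes yp≤′ = reduce-favour q p (favoured-≤ q p (heavy-nonzero hq) yq≤) yp≤′
    (λ j j≢q j≢p → third-light hp hq q≢p j≢p j≢q)
  -- Failure at `p` when `q` is favoured gives `2 y p ≥ 2 + 2a + 2 excess`, and by `excess-other`
  -- the right side is at least `2a + β p`.
  ... | no yq≰ | no yp≰ = reduce-plane p q (q≢p ∘ sym) (heavy-nonzero hp) (heavy-nonzero hq) yp≤ yq≤
    (linear (slack (≰⇒suc≤ yp≰) ⊕ slack (≰⇒suc≤ yp≰) ⊕ slack (excess-other q p q≢p (heavy-nonzero hp)))
      (lemma (y p) a (β p) (excess (favour q p) p)))
    (≰⇒suc≤ yq≰)
    where
    lemma : ∀ y a b e → + 2 * y - (+ 2 * a + b) ≡ y - (1ℤ + (a + e)) + (y - (1ℤ + (a + e)))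
      + (+ 2 * e - (b - + 2))
    lemma = solve-∀

  near-or-reducible : ∀ p → + 2 * y p ≤ + 2 * a + β p ⊎ Reducible
  near-or-reducible p with + 2 * y p ≤? + 2 * a + β p
  ... | yes near = inj₁ near
  ... | no  far  = inj₂ (reduce-axis p (≰⇒suc≤ far))

  reduce : Reducible
  reduce with any? heavy?
  ... | no none = reduce-corner σ σ-unit x≡σy λ j → light-≤ σ σ-unit λ heavy → none (j , heavy)
  ... | yes (p , hp) with near-or-reducible p | any? (λ q → ¬? (q ≟ p) ×-dec heavy? q)
  ...   | inj₂ red | _ = red
  -- With a single heavy coordinate, `p` takes both claims on the free signs.
  ...   | inj₁ near | no none = reduce-favour p p yp≤ yp≤ λ j j≢p _ heavy → none (j , j≢p , heavy)
    where yp≤ = favoured-≤ p p (heavy-nonzero hp) near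
  ...   | inj₁ near | yes (q , q≢p , hq) with near-or-reducible q
  ...     | inj₁ near′ = reduce-two hp hq q≢p near near′
  ...     | inj₂ red   = red

-- A point far from every lattice vector.

M-column-degree : ∀ i → ∑ (λ j → abs (M j i)) ≡ + 2 + + 2 * δ i
M-column-degree = toWitness {a? = all? λ i → ∑ (λ j → abs (M j i)) ℤ.≟ + 2 + + 2 * δ i} tt

∑-abs-mul : ∀ u → ∑ (λ j → abs (mul u j)) ≤ ∑ (λ i → (+ 2 + + 2 * δ i) * abs (u i))
∑-abs-mul u = ≤-trans (∑-mono λ j → abs-∑ (λ i → M j i * u i)) (≤-reflexive
  (trans (∑-swap (λ j i → abs (M j i * u i))) (∑-cong λ i →
    trans (∑-cong λ j → trans (abs-product (M j i) (u i)) (*-comm (abs (M j i)) (abs (u i))))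
    (trans (∑-* (abs (u i)) (λ j → abs (M j i))) (trans (*-comm (abs (u i)) _)
      (cong (_* abs (u i)) (M-column-degree i)))))))

-- For `u ≠ 0` the chain is `|c - D u| ≥ D |u| - c ≥ (e + 2c) |u| - c ≥ c + e |u|`. The surplus `e
-- |u|` is kept to absorb the skew part of the lattice vector.
far-multiple : ∀ {c e D} u → 0ℤ ≤ c → e + + 2 * c ≤ D → c + e * abs u ≤ abs (c - D * u)
far-multiple {c} {e} {D} u 0≤c e+2c≤D with nonzero u
... | inj₁ refl = ≤-reflexive (trans (lemma₁ c e) (trans (sym (0≤i⇒+∣i∣≡i 0≤c)) (cong abs (lemma₂ c D))))
  where
  lemma₁ : ∀ c e → c + e * 0ℤ ≡ c
  lemma₁ = solve-∀
  lemma₂ : ∀ c D → c ≡ c - D * 0ℤ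
  lemma₂ = solve-∀
... | inj₂ 1≤u = linear (slack D|u|≤ ⊕ *-nonneg (slack e+2c≤D) (0≤abs u) ⊕ *-nonneg 0≤c (slack 1≤u)
  ⊕ *-nonneg 0≤c (slack 1≤u))
    (lemma₃ c e D (abs u) (abs (c - D * u)))
  where
  lemma₃ : ∀ c e D u r → r - (c + e * u) ≡ r + c - D * u + (D - (e + + 2 * c)) * u + c * (u - 1ℤ) + c * (u - 1ℤ)
  lemma₃ = solve-∀
  lemma₄ : ∀ c d → - (c - d) + c ≡ d
  lemma₄ = solve-∀
  D|u|≤ : D * abs u ≤ abs (c - D * u) + c
  D|u|≤ = begin
    D * abs u                     ≤⟨ *-monoʳ-≤-nonNeg (abs u) (i≤abs D) ⟩
    abs D * abs u                 ≡⟨ abs-product D u ⟨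
    abs (D * u)                   ≡⟨ cong abs (lemma₄ c (D * u)) ⟨
    abs (- (c - D * u) + c)       ≤⟨ abs-triangle (- (c - D * u)) c ⟩
    abs (- (c - D * u)) + abs c   ≡⟨ cong₂ _+_ (abs-neg (c - D * u)) (0≤i⇒+∣i∣≡i 0≤c) ⟩
    abs (c - D * u) + c           ∎
    where open ≤-Reasoning

-- The skew part `mul u` lowers the norm by at most its own norm, and `∑-abs-mul` bounds this by
-- exactly the surplus that `far-multiple` supplies with `e = 2 + 2 δⱼ`.
norm-minimal : ∀ a c → (∀ j → 0ℤ ≤ c j) → (∀ j → + 2 + + 2 * δ j + + 2 * c j ≤ + 2 * a) →
  ∀ u → ∑ c ≤ ‖ (λ j → c j - (+ 2 * a * u j + mul u j)) ‖
norm-minimal a c 0≤c c≤ u = linear (slack summed ⊕ slack (∑-abs-mul u)) (lemma₁ ‖ x ‖ (∑ c) (∑ e)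
  (∑ λ j → abs (mul u j)))
  where
  x e : Vec₅
  x j = c j - (+ 2 * a * u j + mul u j)
  e j = (+ 2 + + 2 * δ j) * abs (u j)
  lemma₁ : ∀ x c e m → x - c ≡ x + m - (c + e) + (e - m)
  lemma₁ = solve-∀
  lemma₂ : ∀ c d m → c - (d + m) + m ≡ c - d
  lemma₂ = solve-∀
  pointwise : ∀ j → c j + e j ≤ abs (x j) + abs (mul u j)
  pointwise j = ≤-trans (far-multiple {c j} {+ 2 + + 2 * δ j} {+ 2 * a} (u j) (0≤c j) (c≤ j))
    (subst (_≤ abs (x j) + abs (mul u j)) (cong abs (lemma₂ (c j) (+ 2 * a * u j) (mul u j)))
      (abs-triangle (x j) (mul u j)))
  summed : ∑ c + ∑ e ≤ ‖ x ‖ + ∑ (λ j → abs (mul u j))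
  summed = subst₂ _≤_ (∑-+ c e) (∑-+ (λ j → abs (x j)) (λ j → abs (mul u j))) (∑-mono pointwise)

even-or-odd : ∀ t → (∃ λ s → t ≡ + 2 * s) ⊎ (∃ λ s → t ≡ + 2 * s + 1ℤ)
even-or-odd t with t %ℕ 2 | n%ℕd<d t 2 | a≡a%ℕn+[a/ℕn]*n t 2
... | 0 | _ | eq = inj₁ (t /ℕ 2 , trans eq (trans (+-identityˡ _) (*-comm (t /ℕ 2) (+ 2))))
... | 1 | _ | eq = inj₂ (t /ℕ 2 , trans eq (lemma (t /ℕ 2)))
  where
  lemma : ∀ s → 1ℤ + s * + 2 ≡ + 2 * s + 1ℤ
  lemma = solve-∀
... | ℕ.suc (ℕ.suc _) | ℕ.s≤s (ℕ.s≤s ()) | _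

-- An even `t` is absorbed into `u`, since `M` annihilates constants. For odd `t` the map
-- `b ↦ a - b` leads back to the even case, now with minimal norm `5a - ∑ b`; the bounds on `b` are
-- what `norm-minimal` asks of both points.
deep-point : ∀ a b → (∀ j → 0ℤ ≤ b j) → (∀ j → b j ≤ a) →
  (∀ j → + 2 + + 2 * δ j + + 2 * b j ≤ + 2 * a) → (∀ j → + 2 + + 2 * δ j ≤ + 2 * b j) → ∑ b ≤ + 5 * a - ∑ b →
  ∀ t u → ∑ b ≤ ‖ (λ j → b j - lattice a t u j) ‖
deep-point a b 0≤b b≤a b≤ ≤b ∑b≤ t u with even-or-odd t
... | inj₁ (s , refl) = subst (∑ b ≤_)
  (∑-cong λ j → cong abs (trans (cong (λ m → b j - (+ 2 * a * (u j + s) + m)) (mul-shift u s j))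
  (lemma (b j) a (u j) s (mul u j))))
  (norm-minimal a b 0≤b b≤ (λ j → u j + s))
  where
  lemma : ∀ b a u s m → b - (+ 2 * a * (u + s) + m) ≡ b - (+ 2 * s * a + + 2 * a * u + m)
  lemma = solve-∀
... | inj₂ (s , refl) = ≤-trans ∑b≤ (subst₂ _≤_ (lemma₁ a (b 𝟎) (b 𝟏) (b 𝟐) (b 𝟑) (b 𝟒))
  (∑-cong λ j → trans (cong abs (trans (cong (λ m → a - b j - (+ 2 * a * - (u j + s) + m))
    (trans (mul-neg (λ i → u i + s) j) (cong -_ (mul-shift u s j)))) (lemma₂ (b j) a (u j) s (mul u j))))
    (abs-neg (b j - lattice a (+ 2 * s + 1ℤ) u j)))
  (norm-minimal a (λ j → a - b j) (λ j → slack (b≤a j)) (λ j → linear (slack (≤b j))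
    (lemma₃ a (b j) (+ 2 + + 2 * δ j))) (λ j → - (u j + s))))
  where
  lemma₁ : ∀ a b₀ b₁ b₂ b₃ b₄ → a - b₀ + (a - b₁) + (a - b₂) + (a - b₃) + (a - b₄)
    ≡ + 5 * a - (b₀ + b₁ + b₂ + b₃ + b₄)
  lemma₁ = solve-∀
  lemma₂ : ∀ b a u s m → a - b - (+ 2 * a * - (u + s) + - m) ≡ - (b - ((+ 2 * s + 1ℤ) * a + + 2 * a * u + m))
  lemma₂ = solve-∀
  lemma₃ : ∀ a b d → + 2 * a - (d + + 2 * (a - b)) ≡ + 2 * b - d
  lemma₃ = solve-∀

-- Walks in a circulant graph as integer vectors.

append : ∀ {n gs i j l d d′} → Walk n gs i j d → Walk n gs j l d′ → Walk n gs i l (d ℕ.+ d′)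
append nil        w′ = w′
append (cons e w) w′ = cons e (append w w′)

0≰-1 : ¬ 0ℤ ≤ -1ℤ
0≰-1 ()

no-positive-multiple : ∀ {n a b z} → + a < + n → ¬ + a - + b ≡ +[1+ z ] * + n
no-positive-multiple {n} {a} {b} {z} a<n eq = 0≰-1 (linear
  (slack (i<j⇒suc[i]≤j a<n) ⊕ 0≤abs (+ b) ⊕ *-nonneg {+ z} (+≤+ ℕ.z≤n) (+≤+ (ℕ.z≤n {n}))
    ⊕ slack (≤-reflexive (sym eq)))
  (trans (lemma (+ n) (+ a) (+ b) (+ z)) (cong (λ c → + n - (1ℤ + + a) + + b + + z * + n
    + (+ a - + b - c * + n)) (pos-+ 1 z))))
  where
  lemma : ∀ n a b z → -1ℤ - 0ℤ ≡ n - (1ℤ + a) + b + z * n + (a - b - (1ℤ + z) * n)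
  lemma = solve-∀

residue-unique : ∀ {n a b z} → a ℕ.< n → b ℕ.< n → + a - + b ≡ z * + n → a ≡ b
residue-unique {z = +0}       _   _   eq = +-injective (i-j≡0⇒i≡j _ _ eq)
residue-unique {n} {a} {b} {z = +[1+ z ]} a<n _ eq = contradiction eq (no-positive-multiple {n} {a} {b} {z}
  (+<+ a<n))
residue-unique {n} {a} {b} {z = -[1+ z ]} _ b<n eq = contradiction
  (trans (lemma (+ a) (+ b)) (trans (cong -_ eq) (neg-distribˡ-* -[1+ z ] (+ n))))
    (no-positive-multiple {n} {b} {a} {z} (+<+ b<n))
  where
  lemma : ∀ a b → b - a ≡ - (a - b)
  lemma = solve-∀

‖‖-+-axis : ∀ x p {e} → IsUnit e → ‖ (λ j → x j + axis p e j) ‖ ≤ 1ℤ + ‖ x ‖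
‖‖-+-axis x p {e} e-unit = ≤-trans (∑-mono λ j → abs-triangle (x j) (axis p e j))
  (≤-reflexive (trans (∑-+ (λ j → abs (x j)) (λ j → abs (axis p e j))) (trans (cong (λ s → ‖ x ‖ + s) ‖axis‖)
    (+-comm ‖ x ‖ 1ℤ))))
  where
  pointwise : ∀ j → abs (axis p e j) ≡ axis p 1ℤ j
  pointwise j with j ≟ p
  ... | yes _ = trans (sym (abs-*-unit e-unit e)) (cong abs (unit² e-unit))
  ... | no  _ = refl
  ‖axis‖ : ∑ (λ j → abs (axis p e j)) ≡ 1ℤ
  ‖axis‖ = trans (∑-cong pointwise) (∑-[]≔ (λ _ → 0ℤ) p 1ℤ)

module Circulant (n : ℕ) {{_ : NonZero n}} (gs : List ℕ) (g : Fin 5 → ℕ)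
  (g∈gs : ∀ j → g j ∈ gs) (∈gs⇒g : ∀ {h} → h ∈ gs → ∃ λ j → h ≡ g j) where

  φ : Vec₅ → ℤ
  φ x = ∑ λ j → + g j * x j

  φ-+ : ∀ x y → φ (λ j → x j + y j) ≡ φ x + φ y
  φ-+ x y = trans (∑-cong λ j → *-distribˡ-+ (+ g j) (x j) (y j)) (∑-+ (λ j → + g j * x j) (λ j → + g j * y j))

  φ-- : ∀ x y → φ (λ j → x j - y j) ≡ φ x - φ y
  φ-- x y = trans (∑-cong λ j → lemma (+ g j) (x j) (y j))
    (trans (∑-+ (λ j → + g j * x j) (λ j → -1ℤ * (+ g j * y j))) (cong (λ s → φ x + s)
      (trans (∑-* -1ℤ (λ j → + g j * y j)) (-1*i≡-i (φ y)))))
    where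
    lemma : ∀ c x y → c * (x - y) ≡ c * x + -1ℤ * (c * y)
    lemma = solve-∀

  φ-axis : ∀ p e → φ (axis p e) ≡ + g p * e
  φ-axis p e = trans (∑-cong pointwise) (trans (∑-[]≔ (λ _ → 0ℤ) p (+ g p * e)) (lemma (+ g p * e)))
    where
    lemma : ∀ i → 0ℤ + (i - 0ℤ) ≡ i
    lemma = solve-∀
    pointwise : ∀ j → + g j * axis p e j ≡ axis p (+ g p * e) j
    pointwise j with j ≟ p
    ... | yes refl = refl
    ... | no  _    = *-zeroʳ (+ g j)

  walk⇒vector : ∀ {i j d} → Walk n gs i j d →
    Σ Vec₅ λ x → ‖ x ‖ ≤ + d × CongMod (+ toℕ j - + toℕ i) (φ x) n
  walk⇒vector {i} nil = (λ _ → 0ℤ) , ≤-refl , 0ℤ , trans (cong (λ s → + toℕ i - + toℕ i - s) φ0)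
    (lemma (+ toℕ i))
    where
    φ0 : φ (λ _ → 0ℤ) ≡ 0ℤ
    φ0 = ∑-cong {g = λ _ → 0ℤ} λ j → *-zeroʳ (+ g j)
    lemma : ∀ i → i - i - 0ℤ ≡ 0ℤ
    lemma = solve-∀
  walk⇒vector (cons {i} {j} {l} {d} (h , h∈gs , step) w) with ∈gs⇒g h∈gs | walk⇒vector w
  ... | p , refl | x , ‖x‖≤d , z , eq = extend step
    where
    extend-by : ∀ {e} → IsUnit e → CongMod (+ toℕ j - + toℕ i) (+ g p * e) n →
      Σ Vec₅ λ x → ‖ x ‖ ≤ + ℕ.suc d × CongMod (+ toℕ l - + toℕ i) (φ x) n
    extend-by {e} e-unit (z′ , eq′) = (λ j → x j + axis p e j) ,
      ≤-trans (‖‖-+-axis x p e-unit) (+-monoʳ-≤ 1ℤ ‖x‖≤d) , z + z′ ,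
      trans (cong (λ s → + toℕ l - + toℕ i - s) (trans (φ-+ x (axis p e)) (cong (λ s → φ x + s) (φ-axis p e))))
        (trans (lemma (+ toℕ i) (+ toℕ j) (+ toℕ l) (φ x) (+ g p * e)) (trans (cong₂ _+_ eq eq′)
          (sym (*-distribʳ-+ (+ n) z z′))))
      where
      lemma : ∀ i j l x c → l - i - (x + c) ≡ l - j - x + (j - i - c)
      lemma = solve-∀
    extend : _ → _
    extend (inj₁ c) = extend-by plus (subst (λ s → CongMod (+ toℕ j - + toℕ i) s n)
      (sym (*-identityʳ (+ g p))) c)
    extend (inj₂ c) = extend-by minus (subst (λ s → CongMod (+ toℕ j - + toℕ i) s n)
      (trans (sym (-1*i≡-i (+ g p))) (*-comm -1ℤ (+ g p))) c)

  vertex : ℤ → Fin n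
  vertex t = fromℕ< (n%ℕd<d t n)

  toℕ-vertex : ∀ t → + toℕ (vertex t) ≡ t - t /ℕ n * + n
  toℕ-vertex t = trans (cong +_ (toℕ-fromℕ< (n%ℕd<d t n)))
    (trans (lemma (+ (t %ℕ n)) (t /ℕ n * + n)) (cong (λ s → s - t /ℕ n * + n) (sym (a≡a%ℕn+[a/ℕn]*n t n))))
    where
    lemma : ∀ r q → r ≡ r + q - q
    lemma = solve-∀

  vertex-unique : ∀ t i z → + toℕ i - t ≡ z * + n → vertex t ≡ i
  vertex-unique t i z eq = toℕ-injective (residue-unique {z = - (t /ℕ n + z)} (toℕ<n (vertex t)) (toℕ<n i)
    (trans (cong (_- + toℕ i) (toℕ-vertex t)) (trans (lemma₁ t (+ toℕ i) (t /ℕ n * + n))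
      (trans (cong (λ s → - (t /ℕ n * + n) - s) eq) (lemma₂ (t /ℕ n) z (+ n))))))
    where
    lemma₁ : ∀ t i q → t - q - i ≡ - q - (i - t)
    lemma₁ = solve-∀
    lemma₂ : ∀ q z n → - (q * n) - z * n ≡ - (q + z) * n
    lemma₂ = solve-∀

  vertex-difference : ∀ t c → CongMod (+ toℕ (vertex (t + c)) - + toℕ (vertex t)) c n
  vertex-difference t c = t /ℕ n - (t + c) /ℕ n ,
    trans (cong₂ (λ s s′ → s - s′ - c) (toℕ-vertex (t + c)) (toℕ-vertex t)) (lemma t c (t /ℕ n) ((t + c) /ℕ n)
      (+ n))
    where
    lemma : ∀ t c q q′ n → t + c - q′ * n - (t - q * n) - c ≡ (q - q′) * n
    lemma = solve-∀

  segment : ∀ j c t → Walk n gs (vertex t) (vertex (t + + g j * c)) ∣ c ∣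
  segment j +0 t = subst (λ s → Walk n gs (vertex t) (vertex s) 0) (lemma t (+ g j)) nil
    where
    lemma : ∀ t c → t ≡ t + c * 0ℤ
    lemma = solve-∀
  segment j +[1+ c ] t = cons (g j , g∈gs j , inj₁ (vertex-difference t (+ g j)))
    (subst (λ s → Walk n gs (vertex (t + + g j)) (vertex s) c) (lemma t (+ g j) (+ c))
      (segment j (+ c) (t + + g j)))
    where
    lemma : ∀ t g c → t + g + g * c ≡ t + g * (1ℤ + c)
    lemma = solve-∀
  segment j -[1+ 0 ] t = cons (g j , g∈gs j , inj₂ (subst (CongMod′ t) (sym (lemma (+ g j)))
    (vertex-difference t (+ g j * -1ℤ)))) nil
    where
    CongMod′ : ℤ → ℤ → Set
    CongMod′ t s = CongMod (+ toℕ (vertex (t + + g j * -1ℤ)) - + toℕ (vertex t)) s n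
    lemma : ∀ g → - g ≡ g * -1ℤ
    lemma = solve-∀
  segment j -[1+ ℕ.suc c ] t = cons (g j , g∈gs j , inj₂ (vertex-difference t (- + g j)))
    (subst (λ s → Walk n gs (vertex (t - + g j)) (vertex s) (ℕ.suc c)) (lemma t (+ g j) -[1+ c ])
      (segment j -[1+ c ] (t - + g j)))
    where
    lemma : ∀ t g c → t - g + g * c ≡ t + g * (-1ℤ + c)
    lemma = solve-∀

  vector⇒walk : ∀ x t → Σ ℕ λ d → + d ≡ ‖ x ‖ × Walk n gs (vertex t) (vertex (t + φ x)) d
  vector⇒walk x t = _ , refl , subst (λ s → Walk n gs (vertex t) (vertex s) _)
    (lemma t (+ g 𝟎 * x 𝟎) (+ g 𝟏 * x 𝟏) (+ g 𝟐 * x 𝟐) (+ g 𝟑 * x 𝟑) (+ g 𝟒 * x 𝟒))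
    (append (append (append (append (segment 𝟎 (x 𝟎) t) (segment 𝟏 (x 𝟏) t₁)) (segment 𝟐 (x 𝟐) t₂))
      (segment 𝟑 (x 𝟑) t₃)) (segment 𝟒 (x 𝟒) t₄))
    where
    t₁ = t + + g 𝟎 * x 𝟎
    t₂ = t₁ + + g 𝟏 * x 𝟏
    t₃ = t₂ + + g 𝟐 * x 𝟐
    t₄ = t₃ + + g 𝟑 * x 𝟑
    lemma : ∀ t a b c d e → t + a + b + c + d + e ≡ t + (a + b + c + d + e)
    lemma = solve-∀

  covering⇒distance : ∀ {k} → (∀ t → Σ Vec₅ λ x → ‖ x ‖ ≤ + k × CongMod (+ t) (φ x) n) →
    ∀ i j → DistLe n gs i j k
  -- The number `i * pred n` stands for -i modulo `n`, which keeps the target difference a natural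
  -- number.
  covering⇒distance {k} cover i j with cover (toℕ j ℕ.+ toℕ i ℕ.* ℕ.pred n)
  ... | x , ‖x‖≤k , z , eq with vector⇒walk x (+ toℕ i)
  ...   | d , d≡ , w = d , drop‿+≤+ (subst (_≤ + k) (sym d≡) ‖x‖≤k) ,
    subst₂ (λ v v′ → Walk n gs v v′ d) (vertex-unique (+ toℕ i) i 0ℤ (+-inverseʳ (+ toℕ i)))
      (vertex-unique (+ toℕ i + φ x) j (z - + toℕ i) eq′) w
    where
    lemma₁ : ∀ i j p x → j - (i + x) ≡ j + i * p - x - i * (1ℤ + p)
    lemma₁ = solve-∀
    lemma₂ : ∀ z i n → z * n - i * n ≡ (z - i) * n
    lemma₂ = solve-∀
    eq′ : + toℕ j - (+ toℕ i + φ x) ≡ (z - + toℕ i) * + n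
    eq′ = trans (lemma₁ (+ toℕ i) (+ toℕ j) (+ ℕ.pred n) (φ x))
      (trans (cong₂ _-_ (trans (cong (λ s → + toℕ j + s - φ x) (sym (pos-* (toℕ i) (ℕ.pred n)))) eq)
                        (cong (λ s → + toℕ i * + s) (ℕ.suc-pred n)))
             (lemma₂ z (+ toℕ i) (+ n)))

-- Lattice coordinates for the kernel of φ.

abstract
  -- The coefficients express n e₀ and the vectors eᵢ - gᵢ e₀ in the lattice basis.
  kernel-coordinates : ∀ m r z₁ z₂ z₃ z₄ →
    let n  = + 53025 + m * (+ 310830 + m * (+ 732960 + m * (+ 869184 + m * (+ 518400 + m * + 124416))))
        g₁ = + 5251 + m * (+ 24600 + m * (+ 43560 + m * (+ 34560 + m * + 10368)))
        g₂ = + 19281 + m * (+ 111276 + m * (+ 258168 + m * (+ 300960 + m * (+ 176256 + m * + 41472))))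
        g₃ = + 19291 + m * (+ 111288 + m * (+ 258168 + m * (+ 300960 + m * (+ 176256 + m * + 41472))))
        g₄ = + 19806 + m * (+ 113106 + m * (+ 260328 + m * (+ 301824 + m * (+ 176256 + m * + 41472))))
        a  = + 5 + m * + 6
    in Σ ℤ λ t → Σ ℤ λ u₁ → Σ ℤ λ u₂ → Σ ℤ λ u₃ → Σ ℤ λ u₄ →
        (r * n - (g₁ * z₁ + g₂ * z₂ + g₃ * z₃ + g₄ * z₄)
          ≡ t * a + + 2 * a * 0ℤ + (0ℤ * 0ℤ + 0ℤ * u₁ + -1ℤ * u₂ + 1ℤ * u₃ + 0ℤ * u₄))
      × (z₁ ≡ t * a + + 2 * a * u₁ + (0ℤ * 0ℤ + 0ℤ * u₁ + 0ℤ * u₂ + 1ℤ * u₃ + -1ℤ * u₄))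
      × (z₂ ≡ t * a + + 2 * a * u₂ + (1ℤ * 0ℤ + 0ℤ * u₁ + 0ℤ * u₂ + -1ℤ * u₃ + 0ℤ * u₄))
      × (z₃ ≡ t * a + + 2 * a * u₃ + (-1ℤ * 0ℤ + -1ℤ * u₁ + 1ℤ * u₂ + 0ℤ * u₃ + 1ℤ * u₄))
      × (z₄ ≡ t * a + + 2 * a * u₄ + (0ℤ * 0ℤ + 1ℤ * u₁ + 0ℤ * u₂ + -1ℤ * u₃ + 0ℤ * u₄))
  kernel-coordinates m r z₁ z₂ z₃ z₄ =
      ((+ 10401 + m * (+ 48960 + m * (+ 86976 + m * (+ 69120 + m * + 20736)))) * r
        + (- + 1030 + m * (- + 3636 + m * (- + 4320 + m * (- + 1728)))) * z₁
        + (- + 3782 + m * (- + 17460 + m * (- + 30384 + m * (- + 23616 + m * (- + 6912))))) * z₂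
        + (- + 3784 + m * (- + 17460 + m * (- + 30384 + m * (- + 23616 + m * (- + 6912))))) * z₃
        + (- + 3885 + m * (- + 17700 + m * (- + 30528 + m * (- + 23616 + m * (- + 6912))))) * z₄) ,
      ((- + 5250 + m * (- + 24600 + m * (- + 43560 + m * (- + 34560 + m * (- + 10368))))) * r
        + (+ 520 + m * (+ 1824 + m * (+ 2160 + m * + 864))) * z₁
        + (+ 1909 + m * (+ 8772 + m * (+ 15216 + m * (+ 11808 + m * + 3456)))) * z₂
        + (+ 1910 + m * (+ 8772 + m * (+ 15216 + m * (+ 11808 + m * + 3456)))) * z₃
        + (+ 1961 + m * (+ 8892 + m * (+ 15288 + m * (+ 11808 + m * + 3456)))) * z₄) ,
      ((- + 5665 + m * (- + 26178 + m * (- + 45576 + m * (- + 35424 + m * (- + 10368))))) * r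
        + (+ 561 + m * (+ 1932 + m * (+ 2232 + m * + 864))) * z₁
        + (+ 2060 + m * (+ 9332 + m * (+ 15912 + m * (+ 12096 + m * + 3456)))) * z₂
        + (+ 2061 + m * (+ 9332 + m * (+ 15912 + m * (+ 12096 + m * + 3456)))) * z₃
        + (+ 2116 + m * (+ 9458 + m * (+ 15984 + m * (+ 12096 + m * + 3456)))) * z₄) ,
      ((- + 4645 + m * (- + 22554 + m * (- + 41256 + m * (- + 33696 + m * (- + 10368))))) * r
        + (+ 460 + m * (+ 1692 + m * (+ 2088 + m * + 864))) * z₁
        + (+ 1689 + m * (+ 8048 + m * (+ 14424 + m * (+ 11520 + m * + 3456)))) * z₂
        + (+ 1690 + m * (+ 8048 + m * (+ 14424 + m * (+ 11520 + m * + 3456)))) * z₃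
        + (+ 1735 + m * (+ 8162 + m * (+ 14496 + m * (+ 11520 + m * + 3456)))) * z₄) ,
      ((- + 5140 + m * (- + 24348 + m * (- + 43416 + m * (- + 34560 + m * (- + 10368))))) * r
        + (+ 509 + m * (+ 1812 + m * (+ 2160 + m * + 864))) * z₁
        + (+ 1869 + m * (+ 8684 + m * (+ 15168 + m * (+ 11808 + m * + 3456)))) * z₂
        + (+ 1870 + m * (+ 8684 + m * (+ 15168 + m * (+ 11808 + m * + 3456)))) * z₃
        + (+ 1920 + m * (+ 8804 + m * (+ 15240 + m * (+ 11808 + m * + 3456)))) * z₄) ,
      solve (m ∷ r ∷ z₁ ∷ z₂ ∷ z₃ ∷ z₄ ∷ []) ,
      solve (m ∷ r ∷ z₁ ∷ z₂ ∷ z₃ ∷ z₄ ∷ []) ,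
      solve (m ∷ r ∷ z₁ ∷ z₂ ∷ z₃ ∷ z₄ ∷ []) ,
      solve (m ∷ r ∷ z₁ ∷ z₂ ∷ z₃ ∷ z₄ ∷ []) ,
      solve (m ∷ r ∷ z₁ ∷ z₂ ∷ z₃ ∷ z₄ ∷ [])

-- The order and the generators as exact polynomials.

pos-^ : ∀ k e → + (k ℕ.^ e) ≡ (+ k) ^ e
pos-^ k ℕ.zero    = refl
pos-^ k (ℕ.suc e) = trans (pos-* k (k ℕ.^ e)) (cong (+ k *_) (pos-^ k e))

pos-monomial : ∀ c k e → + (c ℕ.* k ℕ.^ e) ≡ + c * (+ k) ^ e
pos-monomial c k e = trans (pos-* c (k ℕ.^ e)) (cong (+ c *_) (pos-^ k e))

pos-quartic : ∀ c₄ c₃ c₂ c₁ c₀ k → + (c₄ ℕ.* k ℕ.^ 4 ℕ.+ c₃ ℕ.* k ℕ.^ 3 ℕ.+ c₂ ℕ.* k ℕ.^ 2 ℕ.+ c₁ ℕ.* k ℕ.+ c₀)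
  ≡ + c₀ + + k * (+ c₁ + + k * (+ c₂ + + k * (+ c₃ + + k * + c₄)))
pos-quartic c₄ c₃ c₂ c₁ c₀ k = trans
  (cong (_+ + c₀) (cong₂ _+_ (cong₂ _+_ (cong₂ _+_ (pos-monomial c₄ k 4) (pos-monomial c₃ k 3))
  (pos-monomial c₂ k 2)) (pos-* c₁ k)))
  (lemma (+ c₄) (+ c₃) (+ c₂) (+ c₁) (+ c₀) (+ k))
  where
  lemma : ∀ c₄ c₃ c₂ c₁ c₀ k → c₄ * (k * (k * (k * (k * 1ℤ)))) + c₃ * (k * (k * (k * 1ℤ))) + c₂ * (k * (k * 1ℤ)) + c₁ * k + c₀ ≡ c₀ + k * (c₁ + k * (c₂ + k * (c₃ + k * c₄)))
  lemma = solve-∀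

pos-quintic : ∀ c₅ c₄ c₃ c₂ c₁ c₀ k → + (c₅ ℕ.* k ℕ.^ 5 ℕ.+ c₄ ℕ.* k ℕ.^ 4 ℕ.+ c₃ ℕ.* k ℕ.^ 3 ℕ.+ c₂ ℕ.* k ℕ.^ 2 ℕ.+ c₁ ℕ.* k ℕ.+ c₀) ≡ + c₀ + + k * (+ c₁ + + k * (+ c₂ + + k * (+ c₃ + + k * (+ c₄ + + k * + c₅))))
pos-quintic c₅ c₄ c₃ c₂ c₁ c₀ k = trans
  (cong (_+ + c₀) (cong₂ _+_ (cong₂ _+_ (cong₂ _+_ (cong₂ _+_ (pos-monomial c₅ k 5) (pos-monomial c₄ k 4))
  (pos-monomial c₃ k 3)) (pos-monomial c₂ k 2)) (pos-* c₁ k)))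
  (lemma (+ c₅) (+ c₄) (+ c₃) (+ c₂) (+ c₁) (+ c₀) (+ k))
  where
  lemma : ∀ c₅ c₄ c₃ c₂ c₁ c₀ k → c₅ * (k * (k * (k * (k * (k * 1ℤ))))) + c₄ * (k * (k * (k * (k * 1ℤ)))) + c₃ * (k * (k * (k * 1ℤ))) + c₂ * (k * (k * 1ℤ)) + c₁ * k + c₀ ≡ c₀ + k * (c₁ + k * (c₂ + k * (c₃ + k * (c₄ + k * c₅))))
  lemma = solve-∀

-- Replaces the truncating division in the definitions by a polynomial identity over ℤ.
exact-quotient : ∀ N d {P} .{{_ : NonZero d}} → 0ℤ ≤ P → + N ≡ P * + d → + (N ℕ./ d) ≡ P
exact-quotient N d {+ p} _ N≡p*d = cong +_ (trans (cong (ℕ._/ d) (+-injective (trans N≡p*d (sym (pos-* p d)))))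
  (ℕ.m*n/n≡m p d))

-- n and the generators as polynomials in m, where k = 15m + 12.
order γ₁ γ₂ γ₃ γ₄ : ℤ → ℤ
order m = + 53025 + m * (+ 310830 + m * (+ 732960 + m * (+ 869184 + m * (+ 518400 + m * + 124416))))
γ₁ m = + 5251 + m * (+ 24600 + m * (+ 43560 + m * (+ 34560 + m * + 10368)))
γ₂ m = + 19281 + m * (+ 111276 + m * (+ 258168 + m * (+ 300960 + m * (+ 176256 + m * + 41472))))
γ₃ m = + 19291 + m * (+ 111288 + m * (+ 258168 + m * (+ 300960 + m * (+ 176256 + m * + 41472))))
γ₄ m = + 19806 + m * (+ 113106 + m * (+ 260328 + m * (+ 301824 + m * (+ 176256 + m * + 41472))))

-- The values at `m = 0` of the far point: 2 and 3 are the integers next to a / 2 = 5/2, and three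
-- twos with two threes have sum 12, the value of `k` there.
residue : Vec₅
residue 𝟑 = + 3
residue 𝟒 = + 3
residue _ = + 2

-- The graph for `k = 15m + 12`.

module CirculantGraph (k : ℕ) (m : ℤ) (0≤m : 0ℤ ≤ m) (k≡ : + k ≡ + 12 + m * + 15) where

  infixr 5 _+m*_
  -- Reads off nonnegativity of a polynomial in Horner form from its coefficients.
  _+m*_ : ∀ c {p} → 0ℤ ≤ p → 0ℤ ≤ + c + m * p
  c +m* 0≤p = +≤+ (ℕ.z≤n {c}) ⊕ *-nonneg 0≤m 0≤p

  const : ∀ c → 0ℤ ≤ + c
  const c = +≤+ ℕ.z≤n

  LCC10-poly : + LCC10 k ≡ order m
  LCC10-poly = exact-quotient _ 3125 (53025 +m* 310830 +m* 732960 +m* 869184 +m* 518400 +m* const 124416)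
    (trans (pos-quintic 512 1280 6080 7840 10010 3741 k)
    (trans (cong (λ k → + 3741 + k * (+ 10010 + k * (+ 7840 + k * (+ 6080 + k * (+ 1280 + k * + 512))))) k≡)
      (lemma m)))
    where
    lemma : ∀ m → let k = + 12 + m * + 15 in
      + 3741 + k * (+ 10010 + k * (+ 7840 + k * (+ 6080 + k * (+ 1280 + k * + 512)))) ≡
      (+ 53025 + m * (+ 310830 + m * (+ 732960 + m * (+ 869184 + m * (+ 518400 + m * + 124416))))) * + 3125
    lemma = solve-∀

  gen2-poly : + gen2 k ≡ γ₁ m
  gen2-poly = exact-quotient _ 625 (5251 +m* 24600 +m* 43560 +m* 34560 +m* const 10368)
    (trans (pos-quartic 128 256 1192 1064 883 k)
    (trans (cong (λ k → + 883 + k * (+ 1064 + k * (+ 1192 + k * (+ 256 + k * + 128)))) k≡) (lemma m)))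
    where
    lemma : ∀ m → let k = + 12 + m * + 15 in
      + 883 + k * (+ 1064 + k * (+ 1192 + k * (+ 256 + k * + 128))) ≡
      (+ 5251 + m * (+ 24600 + m * (+ 43560 + m * (+ 34560 + m * + 10368)))) * + 625
    lemma = solve-∀

  gen3-poly : + gen3 k ≡ γ₂ m
  gen3-poly = exact-quotient _ 9375 (19281 +m* 111276 +m* 258168 +m* 300960 +m* 176256 +m* const 41472)
    (trans (pos-quintic 512 1920 6560 14600 7980 10431 k)
    (trans (cong (λ k → + 10431 + k * (+ 7980 + k * (+ 14600 + k * (+ 6560 + k * (+ 1920 + k * + 512))))) k≡)
      (lemma m)))
    where
    lemma : ∀ m → let k = + 12 + m * + 15 in
      + 10431 + k * (+ 7980 + k * (+ 14600 + k * (+ 6560 + k * (+ 1920 + k * + 512)))) ≡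
      (+ 19281 + m * (+ 111276 + m * (+ 258168 + m * (+ 300960 + m * (+ 176256 + m * + 41472))))) * + 9375
    lemma = solve-∀

  gen4-poly : + gen4 k ≡ γ₃ m
  gen4-poly = exact-quotient _ 9375 (19291 +m* 111288 +m* 258168 +m* 300960 +m* 176256 +m* const 41472)
    (trans (pos-quintic 512 1920 6560 14600 15480 14181 k)
    (trans (cong (λ k → + 14181 + k * (+ 15480 + k * (+ 14600 + k * (+ 6560 + k * (+ 1920 + k * + 512))))) k≡)
      (lemma m)))
    where
    lemma : ∀ m → let k = + 12 + m * + 15 in
      + 14181 + k * (+ 15480 + k * (+ 14600 + k * (+ 6560 + k * (+ 1920 + k * + 512)))) ≡
      (+ 19291 + m * (+ 111288 + m * (+ 258168 + m * (+ 300960 + m * (+ 176256 + m * + 41472))))) * + 9375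
    lemma = solve-∀

  gen5-poly : + gen5 k ≡ γ₄ m
  gen5-poly = exact-quotient _ 9375 (19806 +m* 113106 +m* 260328 +m* 301824 +m* 176256 +m* const 41472)
    (trans (pos-quintic 512 1920 8960 18200 28530 20106 k)
    (trans (cong (λ k → + 20106 + k * (+ 28530 + k * (+ 18200 + k * (+ 8960 + k * (+ 1920 + k * + 512))))) k≡)
      (lemma m)))
    where
    lemma : ∀ m → let k = + 12 + m * + 15 in
      + 20106 + k * (+ 28530 + k * (+ 18200 + k * (+ 8960 + k * (+ 1920 + k * + 512)))) ≡
      (+ 19806 + m * (+ 113106 + m * (+ 260328 + m * (+ 301824 + m * (+ 176256 + m * + 41472))))) * + 9375
    lemma = solve-∀

  a : ℤ
  a = + 5 + m * + 6

  generator : Fin 5 → ℕ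
  generator 𝟎 = 1
  generator 𝟏 = gen2 k
  generator 𝟐 = gen3 k
  generator 𝟑 = gen4 k
  generator 𝟒 = gen5 k

  generator∈generators : ∀ j → generator j ∈ generators k
  generator∈generators 𝟎 = here refl
  generator∈generators 𝟏 = there (here refl)
  generator∈generators 𝟐 = there (there (here refl))
  generator∈generators 𝟑 = there (there (there (here refl)))
  generator∈generators 𝟒 = there (there (there (there (here refl))))

  ∈generators⇒generator : ∀ {h} → h ∈ generators k → ∃ λ j → h ≡ generator j
  ∈generators⇒generator (here eq) = 𝟎 , eq
  ∈generators⇒generator (there (here eq)) = 𝟏 , eq
  ∈generators⇒generator (there (there (here eq))) = 𝟐 , eq
  ∈generators⇒generator (there (there (there (here eq)))) = 𝟑 , eq
  ∈generators⇒generator (there (there (there (there (here eq))))) = 𝟒 , eq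

  φ-polynomial : ∀ (x : Vec₅) → ∑ (λ j → + generator j * x j) ≡
    1ℤ * x 𝟎 + γ₁ m * x 𝟏 + γ₂ m * x 𝟐 + γ₃ m * x 𝟑 + γ₄ m * x 𝟒
  φ-polynomial x = cong₂ _+_ (cong₂ _+_ (cong₂ _+_ (cong (λ c → 1ℤ * x 𝟎 + c * x 𝟏) gen2-poly)
    (cong (_* x 𝟐) gen3-poly)) (cong (_* x 𝟑) gen4-poly)) (cong (_* x 𝟒) gen5-poly)

  lattice⇒kernel : ∀ t u → ∃ λ z → ∑ (λ j → + generator j * lattice a t u j) ≡ z * + LCC10 k
  lattice⇒kernel t u = z , trans (φ-polynomial (lattice a t u))
    (trans (lemma m t (u 𝟎) (u 𝟏) (u 𝟐) (u 𝟑) (u 𝟒)) (cong (z *_) (sym LCC10-poly)))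
    where
    -- The coefficients are the values of φ at the lattice generators, divided by `n`. The generator
    -- belonging to `u 𝟎` has value 0, since `γ₃ m - γ₂ m = 2a`.
    z = t * (+ 6 + + 6 * m) + u 𝟏 + (+ 4 + + 4 * m) * u 𝟐 + (+ 3 + + 4 * m) * u 𝟑 + (+ 4 + + 4 * m) * u 𝟒
    lemma : ∀ m t u₀ u₁ u₂ u₃ u₄ → let a = + 5 + m * + 6 in
        1ℤ * (t * a + + 2 * a * u₀ + (0ℤ * u₀ + 0ℤ * u₁ + -1ℤ * u₂ + 1ℤ * u₃ + 0ℤ * u₄))
      + (+ 5251 + m * (+ 24600 + m * (+ 43560 + m * (+ 34560 + m * + 10368))))
          * (t * a + + 2 * a * u₁ + (0ℤ * u₀ + 0ℤ * u₁ + 0ℤ * u₂ + 1ℤ * u₃ + -1ℤ * u₄))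
      + (+ 19281 + m * (+ 111276 + m * (+ 258168 + m * (+ 300960 + m * (+ 176256 + m * + 41472)))))
          * (t * a + + 2 * a * u₂ + (1ℤ * u₀ + 0ℤ * u₁ + 0ℤ * u₂ + -1ℤ * u₃ + 0ℤ * u₄))
      + (+ 19291 + m * (+ 111288 + m * (+ 258168 + m * (+ 300960 + m * (+ 176256 + m * + 41472)))))
          * (t * a + + 2 * a * u₃ + (-1ℤ * u₀ + -1ℤ * u₁ + 1ℤ * u₂ + 0ℤ * u₃ + 1ℤ * u₄))
      + (+ 19806 + m * (+ 113106 + m * (+ 260328 + m * (+ 301824 + m * (+ 176256 + m * + 41472)))))
          * (t * a + + 2 * a * u₄ + (0ℤ * u₀ + 1ℤ * u₁ + 0ℤ * u₂ + -1ℤ * u₃ + 0ℤ * u₄))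
      ≡ (t * (+ 6 + + 6 * m) + u₁ + (+ 4 + + 4 * m) * u₂ + (+ 3 + + 4 * m) * u₃ + (+ 4 + + 4 * m) * u₄)
          * (+ 53025 + m * (+ 310830 + m * (+ 732960 + m * (+ 869184 + m * (+ 518400 + m * + 124416)))))
    lemma = solve-∀

  kernel⇒lattice : ∀ x r → ∑ (λ j → + generator j * x j) ≡ r * + LCC10 k →
    Σ ℤ λ t → Σ Vec₅ λ u → ∀ j → x j ≡ lattice a t u j
  kernel⇒lattice x r eq with kernel-coordinates m r (x 𝟏) (x 𝟐) (x 𝟑) (x 𝟒)
  ... | t , u₁ , u₂ , u₃ , u₄ , eq₀ , eq₁ , eq₂ , eq₃ , eq₄ = t , u , coordinate
    where
    u : Vec₅
    -- This normalisation is possible because adding 1 to every entry of `u` and subtracting 2 from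
    -- `t` fixes the lattice vector.
    u 𝟎 = 0ℤ
    u 𝟏 = u₁
    u 𝟐 = u₂
    u 𝟑 = u₃
    u 𝟒 = u₄
    isolate : ∀ x p q r s → x ≡ 1ℤ * x + p + q + r + s - (p + q + r + s)
    isolate = solve-∀
    coordinate : ∀ j → x j ≡ lattice a t u j
    coordinate 𝟎 = trans (isolate (x 𝟎) (γ₁ m * x 𝟏) (γ₂ m * x 𝟐) (γ₃ m * x 𝟑) (γ₄ m * x 𝟒))
      (trans (cong (_- (γ₁ m * x 𝟏 + γ₂ m * x 𝟐 + γ₃ m * x 𝟑 + γ₄ m * x 𝟒)) (trans (sym (φ-polynomial x))
        (trans eq (cong (r *_) LCC10-poly)))) eq₀)
    coordinate 𝟏 = eq₁
    coordinate 𝟐 = eq₂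
    coordinate 𝟑 = eq₃
    coordinate 𝟒 = eq₄

  5≤a : + 5 ≤ a
  5≤a = linear (*-nonneg 0≤m (const 6)) (lemma m)
    where
    lemma : ∀ m → + 5 + m * + 6 - + 5 ≡ m * + 6
    lemma = solve-∀

  5a≡2k+1 : + 5 * a ≡ + 2 * + k + 1ℤ
  5a≡2k+1 = trans (lemma m) (cong (λ k → + 2 * k + 1ℤ) (sym k≡))
    where
    lemma : ∀ m → + 5 * (+ 5 + m * + 6) ≡ + 2 * (+ 12 + m * + 15) + 1ℤ
    lemma = solve-∀

  b : Vec₅
  b j = residue j + m * + 3

  ∑b≡k : ∑ b ≡ + k
  ∑b≡k = trans (lemma m) (sym k≡)
    where
    lemma : ∀ m → let c = + 2 + m * + 3; d = + 3 + m * + 3 in c + c + c + d + d ≡ + 12 + m * + 15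
    lemma = solve-∀

  b-deep : ∀ t u → + k ≤ ‖ (λ j → b j - lattice a t u j) ‖
  b-deep t u = subst (_≤ ‖ (λ j → b j - lattice a t u j) ‖) ∑b≡k
    (deep-point a b 0≤b b≤a b-upper b-lower ∑b≤ t u)
    where
    lemma₁ : ∀ m c → + 5 + m * + 6 - (c + m * + 3) ≡ + 5 - c + m * + 3
    lemma₁ = solve-∀
    lemma₂ : ∀ m c d → + 2 * (+ 5 + m * + 6) - (+ 2 + + 2 * d + + 2 * (c + m * + 3))
      ≡ + 8 - + 2 * d - + 2 * c + m * + 6
    lemma₂ = solve-∀
    lemma₃ : ∀ m c d → + 2 * (c + m * + 3) - (+ 2 + + 2 * d) ≡ + 2 * c - + 2 - + 2 * d + m * + 6
    lemma₃ = solve-∀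
    0≤m* : ∀ c → 0ℤ ≤ m * + c
    0≤m* c = *-nonneg 0≤m (const c)
    0≤b : ∀ j → 0ℤ ≤ b j
    0≤b j = toWitness {a? = all? λ j → 0ℤ ≤? residue j} tt j ⊕ 0≤m* 3
    b≤a : ∀ j → b j ≤ a
    b≤a j = linear (toWitness {a? = all? λ j → 0ℤ ≤? + 5 - residue j} tt j ⊕ 0≤m* 3) (lemma₁ m (residue j))
    b-upper : ∀ j → + 2 + + 2 * δ j + + 2 * b j ≤ + 2 * a
    b-upper j = linear (toWitness {a? = all? λ j → 0ℤ ≤? + 8 - + 2 * δ j - + 2 * residue j} tt j
      ⊕ 0≤m* 6) (lemma₂ m (residue j) (δ j))
    b-lower : ∀ j → + 2 + + 2 * δ j ≤ + 2 * b j
    b-lower j = linear (toWitness {a? = all? λ j → 0ℤ ≤? + 2 * residue j - + 2 - + 2 * δ j} tt j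
      ⊕ 0≤m* 6) (lemma₃ m (residue j) (δ j))
    lemma₄ : ∀ s → + 2 * s + 1ℤ - s - s ≡ 1ℤ
    lemma₄ = solve-∀
    ∑b≤ : ∑ b ≤ + 5 * a - ∑ b
    -- Here `5a - k = k + 1`, so the slack is 1.
    ∑b≤ = subst (λ s → s ≤ + 5 * a - s) (sym ∑b≡k) (linear {s = 1ℤ} (const 1)
      (trans (cong (λ s → s - + k - + k) 5a≡2k+1) (lemma₄ (+ k))))

  1≤order : 1ℤ ≤ order m
  1≤order = linear (53024 +m* 310830 +m* 732960 +m* 869184 +m* 518400 +m* const 124416)
    (lemma (m * (+ 310830 + m * (+ 732960 + m * (+ 869184 + m * (+ 518400 + m * + 124416))))))
    where
    lemma : ∀ s → + 53025 + s - 1ℤ ≡ + 53024 + s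
    lemma = solve-∀

  instance
    LCC10-nonZero : NonZero (LCC10 k)
    LCC10-nonZero = ℕ.>-nonZero (drop‿+≤+ (subst (1ℤ ≤_) (sym LCC10-poly) 1≤order))

  open Circulant (LCC10 k) (generators k) generator generator∈generators ∈generators⇒generator

  -- Both bounds on the diameter.

  Covered : ℕ → Set
  Covered t = Σ Vec₅ λ x → ‖ x ‖ ≤ + k × CongMod (+ t) (φ x) (LCC10 k)

  translate : ∀ {t} x t′ u z → + t - φ x ≡ z * + LCC10 k →
    CongMod (+ t) (φ (λ j → x j - lattice a t′ u j)) (LCC10 k)
  translate {t} x t′ u z eq = z + proj₁ in-kernel ,
    trans (cong (λ s → + t - s) (φ-- x (lattice a t′ u)))
    (trans (lemma (+ t) (φ x) (φ (lattice a t′ u)))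
    (trans (cong₂ _+_ eq (proj₂ in-kernel)) (sym (*-distribʳ-+ (+ LCC10 k) z (proj₁ in-kernel)))))
    where
    in-kernel = lattice⇒kernel t′ u
    lemma : ∀ t p q → t - (p - q) ≡ t - p + q
    lemma = solve-∀

  cover-zero : Covered 0
  cover-zero = (λ _ → 0ℤ) , const k , 0ℤ ,
    cong (λ s → 0ℤ - s) (∑-cong {g = λ _ → 0ℤ} λ j → *-zeroʳ (+ generator j))

  -- The generator at `𝟎` is 1, so adding e₀ advances the residue by one. The norm rises to `k + 1`
  -- at worst, which is precisely the norm that `reduce` handles, and subtracting a lattice vector
  -- keeps the residue.
  cover-suc : ∀ {t} → Covered t → Covered (ℕ.suc t)
  cover-suc {t} (x , ‖x‖≤k , z , eq) = advance (‖ x′ ‖ ≤? + k)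
    where
    x′ : Vec₅
    x′ j = x j + axis 𝟎 1ℤ j
    eq′ : + ℕ.suc t - φ x′ ≡ z * + LCC10 k
    eq′ = trans (cong (λ s → + ℕ.suc t - s) (trans (φ-+ x (axis 𝟎 1ℤ)) (cong (λ s → φ x + s) (φ-axis 𝟎 1ℤ))))
      (trans (lemma (+ t) (φ x)) eq)
      where
      lemma : ∀ t s → 1ℤ + t - (s + 1ℤ) ≡ t - s
      lemma = solve-∀
    descend : (Σ ℤ λ t′ → Σ Vec₅ λ u → ‖ (λ j → x′ j - lattice a t′ u j) ‖ ≤ + k) → Covered (ℕ.suc t)
    descend (t′ , u , ‖x″‖≤k) = (λ j → x′ j - lattice a t′ u j) , ‖x″‖≤k , translate x′ t′ u z eq′
    advance : Dec (‖ x′ ‖ ≤ + k) → Covered (ℕ.suc t)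
    advance (yes ‖x′‖≤k) = x′ , ‖x′‖≤k , z , eq′
    advance (no  ‖x′‖≰k) = descend (Reduction.reduce a (+ k) 5≤a 5a≡2k+1 x′
      (≤-antisym (≤-trans (‖‖-+-axis x 𝟎 plus) (+-monoʳ-≤ 1ℤ ‖x‖≤k)) (≰⇒suc≤ ‖x′‖≰k)))

  cover : ∀ t → Covered t
  cover ℕ.zero    = cover-zero
  cover (ℕ.suc t) = cover-suc (cover t)

  -- The difference `b - x` lies in the kernel, hence in the lattice, so `x` is `b` minus a lattice
  -- vector and `b-deep` applies.
  ‖‖-≥k : ∀ x z → φ b - φ x ≡ z * + LCC10 k → + k ≤ ‖ x ‖
  ‖‖-≥k x z eq = in-lattice (kernel⇒lattice (λ j → b j - x j) z (trans (φ-- b x) eq))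
    where
    lemma : ∀ b x → b - (b - x) ≡ x
    lemma = solve-∀
    in-lattice : (Σ ℤ λ t → Σ Vec₅ λ u → ∀ j → b j - x j ≡ lattice a t u j) → + k ≤ ‖ x ‖
    in-lattice (t , u , b-x≡) = ≤-trans (b-deep t u) (≤-reflexive (∑-cong λ j → cong abs
      (trans (cong (λ s → b j - s) (sym (b-x≡ j))) (lemma (b j) (x j)))))

  -- A shorter walk would yield a vector congruent to `b` under φ of norm at most `pred k`;
  -- positivity of `k` makes this less than `k`.
  far-apart : 1 ℕ.≤ k → ¬ DistLe (LCC10 k) (generators k) (vertex 0ℤ) (vertex (0ℤ + φ b)) (ℕ.pred k)
  far-apart 1≤k (d , d≤ , w) = too-short (walk⇒vector w) (vertex-difference 0ℤ (φ b))
    where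
    v = + toℕ (vertex (0ℤ + φ b)) - + toℕ (vertex 0ℤ)
    lemma₁ : ∀ v b x → b - x ≡ v - x - (v - b)
    lemma₁ = solve-∀
    lemma₂ : ∀ z z′ n → z * n - z′ * n ≡ (z - z′) * n
    lemma₂ = solve-∀
    too-short : (Σ Vec₅ λ x → ‖ x ‖ ≤ + d × CongMod v (φ x) (LCC10 k)) → ¬ CongMod v (φ b) (LCC10 k)
    too-short (x , ‖x‖≤d , z , eq) (z′ , eq′) = contradiction
      (ℕ.≤-trans (drop‿+≤+ (≤-trans (‖‖-≥k x (z - z′)
        (trans (lemma₁ v (φ b) (φ x)) (trans (cong₂ _-_ eq eq′) (lemma₂ z z′ (+ LCC10 k))))) ‖x‖≤d)) d≤)
      (ℕ.<⇒≱ (ℕ.≤-reflexive (ℕ.suc-pred k {{ℕ.>-nonZero 1≤k}})))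

theorem7 : (k : ℕ) → 1 ℕ.≤ k → k ℕ.% 15 ≡ 12 →
    HasDiameter (LCC10 k) (generators k) k
theorem7 k 1≤k k%15≡12 = covering⇒distance cover , _ , _ , far-apart 1≤k
  where
  k≡ : + k ≡ + 12 + + (k ℕ./ 15) * + 15
  k≡ = trans (cong +_ (trans (ℕ.m≡m%n+[m/n]*n k 15) (cong (ℕ._+ k ℕ./ 15 ℕ.* 15) k%15≡12)))
    (cong (λ s → + 12 + s) (pos-* (k ℕ./ 15) 15))
  open CirculantGraph k (+ (k ℕ./ 15)) (+≤+ ℕ.z≤n) k≡
  open Circulant (LCC10 k) (generators k) generator generator∈generators ∈generators⇒generator using
    (covering⇒distance)
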